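{- Let $G_{0}=(V,E)$ be an equitably $l$-colorable graph with a spanning subgraph $Z_{0}$ such that $\delta(Z_{0})\geq 1$, and $|E(Z_{0})|\geq |V|-1$ when $\delta(G_{0})=1$. Then there is an equitably $l$-colorable graph $G\in \mathcal{R}(\pi(G_{0}),G_{0}-E(Z_{0}))$ such that $G$ is $(\delta(G)-1)$-edge-connected when $\delta(G)\geq 3$ and $\delta(G)$ is odd, and $G$ is maximally edge-connected otherwise.
   Context: All graphs are finite and simple. $\delta(\cdot)$ denotes minimum degree. A (proper) coloring with $l$ colors is equitable if its color classes pairwise differ in size by at most one. $\pi(G_0)$ is the degree sequence of $G_0$; for a subgraph $Z$ of $G_0$, $\mathcal{R}(\pi(G_0),Z)$ is the set of graphs $W$ on vertex set $V$ with $\deg_W(v)=\deg_{G_0}(v)$ for all $v$ and $E(Z)\subseteq E(W)$. A graph is $t$-edge-connected if it remains connected after deleting any fewer than $t$ edges; it is maximally edge-connected if its edge-connectivity equals its minimum degree. -}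

module Defs where

open import Data.Nat using (ℕ; zero; suc; _+_; _∸_; _≤_; _<_; _%_)
open import Data.Bool using (Bool; true; false; _∧_; not; if_then_else_)
open import Data.Fin using (Fin; toℕ)
import Data.Fin as Fin
open import Data.List using (List; map; allFin)
open import Data.Nat.ListAction using (sum)
open import Data.Product using (Σ; ∃; _×_; _,_)
open import Relation.Nullary using (¬_; does)
open import Relation.Binary.PropositionalEquality using (_≡_; _≢_; refl; cong₂)

record Graph (n : ℕ) : Set where
  field
    adj    : Fin n → Fin n → Bool
    sym    : ∀ u v → adj u v ≡ adj v u
    irrefl : ∀ v → adj v v ≡ false
open Graph public

private
  ind : Bool → ℕ
  ind b = if b then 1 else 0

deg : ∀ {n} → Graph n → Fin n → ℕ
deg {n} G v = sum (map (λ u → ind (adj G v u)) (allFin n))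

edgeCount : ∀ {n} → Graph n → ℕ
edgeCount {n} G =
  sum (map (λ u → sum (map (λ v → ind (adj G u v ∧ does (toℕ u Data.Nat.<? toℕ v))) (allFin n))) (allFin n))
  where import Data.Nat

IsMinDeg : ∀ {n} → Graph n → ℕ → Set
IsMinDeg G d = (∃ λ v → deg G v ≡ d) × (∀ v → d ≤ deg G v)

_⊆E_ : ∀ {n} → Graph n → Graph n → Set
H ⊆E G = ∀ u v → adj H u v ≡ true → adj G u v ≡ true

_∖E_ : ∀ {n} → Graph n → Graph n → Graph n
G ∖E H = record
  { adj    = λ u v → adj G u v ∧ not (adj H u v)
  ; sym    = λ u v → cong₂ (λ a b → a ∧ not b) (sym G u v) (sym H u v)
  ; irrefl = λ v → irr v }
  where
  irr : ∀ v → adj G v v ∧ not (adj H v v) ≡ false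
  irr v rewrite irrefl G v = refl

InR : ∀ {n} → Graph n → Graph n → Graph n → Set
InR G0 Z W = (∀ v → deg W v ≡ deg G0 v) × (Z ⊆E W)

classSize : ∀ {n l} → (Fin n → Fin l) → Fin l → ℕ
classSize {n} c i = sum (map (λ v → ind (does (c v Fin.≟ i))) (allFin n))

IsEquitableColoring : ∀ {n} → Graph n → (l : ℕ) → (Fin n → Fin l) → Set
IsEquitableColoring G l c =
  (∀ u v → adj G u v ≡ true → c u ≢ c v) ×
  (∀ i j → classSize c i ≤ classSize c j + 1)

EquitablyColorable : ∀ {n} → Graph n → ℕ → Set
EquitablyColorable {n} G l = Σ (Fin n → Fin l) (IsEquitableColoring G l)

data Walk {n} (G : Graph n) : Fin n → Fin n → Set where
  here : ∀ {u} → Walk G u u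
  step : ∀ {u w v} → adj G u w ≡ true → Walk G w v → Walk G u v

Connected : ∀ {n} → Graph n → Set
Connected {n} G = ∀ (u v : Fin n) → Walk G u v

EdgeConnected : ∀ {n} → ℕ → Graph n → Set
EdgeConnected {n} t G = ∀ (F : Graph n) → F ⊆E G → edgeCount F < t → Connected (G ∖E F)

IsEdgeConnectivity : ∀ {n} → Graph n → ℕ → Set
IsEdgeConnectivity G k = EdgeConnected k G × ¬ EdgeConnected (suc k) G

MaximallyEdgeConnected : ∀ {n} → Graph n → Set
MaximallyEdgeConnected G = ∀ d → IsMinDeg G d → IsEdgeConnectivity G d

Odd : ℕ → Set
Odd d = d % 2 ≡ 1

{-# OPTIONS --safe #-}

-- Fix the colouring c and exchange only edges of Z, the current copy of Z₀, inside G = F ∪ Z with F = G₀ ∖ Z₀.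
-- Let t be the connectivity to reach and let Σ_S (t ∸ |∂S|), over all vertex sets S, be the potential;
-- its terms at proper nonempty S all vanish exactly when G is t-edge-connected.
--
-- For t even, take an inclusion-minimal deficient set X and a minimal deficient set Y disjoint from it. Counting
-- edges, each contains adjacent vertices all of whose neighbours stay inside; replace Z-edges xy, uv at such x ∈ X
-- and u ∈ Y by xv, uy or by xu, yv. One of the two respects c. By minimality and parity a set splitting both X
-- and Y has at least t + 2 boundary edges, so losing two does no harm, while ∂X grows: the potential drops. If all
-- such swaps are blocked by an existing edge yv, the colours are forced and an exchange along an alternating
-- 8-cycle works instead.
--
-- For t = 1, deleting a bridge doubles the number of sets without boundary, so a disconnected Z with at least n ∸ 1
-- edges has an edge xy that is not a bridge, and swapping it with an edge of another component joins the two sides.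
module Submission where

open import Defs
open import Data.Nat using (ℕ; zero; suc; _+_; _*_; _∸_; _^_; _≤_; _<_; _%_; z≤n; s≤s; _≤?_; _<?_)
import Data.Nat as ℕ
open import Data.Nat.Properties hiding (_≟_)
open import Data.Nat.Induction using (<-wellFounded)
open import Data.Nat.Tactic.RingSolver using (solve-∀)
open import Data.Nat.DivMod using (m≡m%n+[m/n]*n; m%n<n; _/_)
open import Data.Bool using (Bool; true; false; _∧_; _∨_; _xor_; not; if_then_else_)
import Data.Bool as Bool
open import Data.Bool.Properties using (∧-comm; ∨-comm; ¬-not)
open import Data.Fin using (Fin; zero; suc; toℕ; _≟_)
open import Data.Fin.Properties using (any?; all?; toℕ-injective)
import Data.List as List
open import Data.List.Properties using (map-tabulate)
import Data.Nat.ListAction as ListAction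
open import Data.Vec.Functional using (Vector)
open import Data.Product using (Σ; ∃; ∃-syntax; _×_; _,_; proj₁; proj₂)
open import Data.Sum using (_⊎_; inj₁; inj₂; [_,_]′)
open import Function using (_∘_; id; flip; case_of_)
open import Induction.WellFounded using (Acc; acc)
open import Relation.Nullary using (¬_; Dec; yes; no; does; contradiction)
open import Relation.Nullary.Decidable using (map′; _×-dec_; _→-dec_; _⊎-dec_; ¬?; dec-true; dec-false; toWitness)
open import Relation.Binary using (tri<; tri≈; tri>)
open import Relation.Unary using (Decidable)
open import Relation.Binary.PropositionalEquality as ≡ using (_≡_; _≢_; _≗_; refl; cong; cong₂; subst; trans; module ≡-Reasoning)
import Algebra.Properties.CommutativeMonoid.Sum +-0-commutativeMonoid as Sum

-- Booleans and indicator values.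

when : Bool → ℕ → ℕ
when b k = if b then k else 0

ind : Bool → ℕ
ind b = when b 1

-- Lets inequalities between indicator sums be settled by evaluating every pattern of membership.
∀-bool? : {P : Bool → Set} → Decidable P → Dec (∀ b → P b)
∀-bool? P? = map′ (λ { (f , t) false → f ; (f , t) true → t }) (λ p → p false , p true)
                  (P? false ×-dec P? true)

∧-trueˡ : ∀ {a b} → a ∧ b ≡ true → a ≡ true
∧-trueˡ {true} _ = refl

∧-trueʳ : ∀ {a b} → a ∧ b ≡ true → b ≡ true
∧-trueʳ {true} b = b

∨-true⁻ : ∀ {a b} → a ∨ b ≡ true → a ≡ true ⊎ b ≡ true
∨-true⁻ {true}  _ = inj₁ refl
∨-true⁻ {false} b = inj₂ b

∨-trueˡ : ∀ {a b} → a ≡ true → a ∨ b ≡ true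
∨-trueˡ refl = refl

∨-trueʳ : ∀ {a b} → b ≡ true → a ∨ b ≡ true
∨-trueʳ {true}  _ = refl
∨-trueʳ {false} b = b

clash : ∀ {b} {A : Set} → b ≡ true → b ≡ false → A
clash refl ()

when-0 : ∀ b → when b 0 ≡ 0
when-0 true  = refl
when-0 false = refl

when-+ : ∀ b k m → when b (k + m) ≡ when b k + when b m
when-+ true  k m = refl
when-+ false k m = refl

when-comm : ∀ a b k → when a (when b k) ≡ when b (when a k)
when-comm true  b k = refl
when-comm false b k = ≡.sym (when-0 b)

ind-∧ : ∀ a b → ind (a ∧ b) ≡ when a (ind b)
ind-∧ true  b = refl
ind-∧ false b = refl

does-comm : ∀ {n} (p q : Fin n) → does (p ≟ q) ≡ does (q ≟ p)
does-comm p q with p ≟ q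
... | yes refl = ≡.sym (dec-true (p ≟ p) refl)
... | no p≢q   = ≡.sym (dec-false (q ≟ p) (p≢q ∘ ≡.sym))

does⁻ : ∀ {n} {p q : Fin n} → does (p ≟ q) ≡ true → p ≡ q
does⁻ {p = p} {q} eq with yes p≡q ← p ≟ q = p≡q

-- Finite sums over vertices.

-- Opaque so that unification never unfolds sums.
opaque
  ∑ : ∀ {n} → Vector ℕ n → ℕ
  ∑ = Sum.sum

  ∑-cong : ∀ {n} {f g : Vector ℕ n} → f ≗ g → ∑ f ≡ ∑ g
  ∑-cong = Sum.sum-cong-≗

  ∑-distrib-+ : ∀ {n} (f g : Vector ℕ n) → ∑ (λ i → f i + g i) ≡ ∑ f + ∑ g
  ∑-distrib-+ = Sum.∑-distrib-+

  ∑-comm : ∀ {m n} (f : Fin m → Fin n → ℕ) →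
           ∑ (λ i → ∑ λ j → f i j) ≡ ∑ (λ j → ∑ λ i → f i j)
  ∑-comm = Sum.∑-comm

  ∑-0 : ∀ n → ∑ {n} (λ _ → 0) ≡ 0
  ∑-0 zero    = refl
  ∑-0 (suc n) = ∑-0 n

  ∑-mono : ∀ {n} {f g : Vector ℕ n} → (∀ i → f i ≤ g i) → ∑ f ≤ ∑ g
  ∑-mono {zero}  f≤g = z≤n
  ∑-mono {suc n} f≤g = +-mono-≤ (f≤g zero) (∑-mono (f≤g ∘ suc))

  ∑-mono-< : ∀ {n} {f g : Vector ℕ n} i → (∀ i → f i ≤ g i) → f i < g i → ∑ f < ∑ g
  ∑-mono-< zero    f≤g fi<gi = +-mono-<-≤ fi<gi (∑-mono (f≤g ∘ suc))
  ∑-mono-< (suc i) f≤g fi<gi = +-mono-≤-< (f≤g zero) (∑-mono-< i (f≤g ∘ suc) fi<gi)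

  term≤∑ : ∀ {n} (f : Vector ℕ n) i → f i ≤ ∑ f
  term≤∑ f zero    = m≤m+n _ _
  term≤∑ f (suc i) = ≤-trans (term≤∑ (f ∘ suc) i) (m≤n+m _ _)

  ∑-positive : ∀ {n} (f : Vector ℕ n) → 1 ≤ ∑ f → ∃[ i ] 1 ≤ f i
  ∑-positive {suc n} f pos with f zero in eq
  ... | zero  = let i , p = ∑-positive (f ∘ suc) pos in suc i , p
  ... | suc k = zero , subst (1 ≤_) (≡.sym eq) (s≤s z≤n)

  ∑-when : ∀ {n} b (f : Vector ℕ n) → ∑ (λ i → when b (f i)) ≡ when b (∑ f)
  ∑-when     true  f = refl
  ∑-when {n} false f = ∑-0 n

  ∑-single : ∀ {n} (a : Fin n) (f : Vector ℕ n) → ∑ (λ i → when (does (i ≟ a)) (f i)) ≡ f a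
  ∑-single {suc n} zero    f = trans (cong (f zero +_) (∑-0 n)) (+-identityʳ _)
  ∑-single {suc n} (suc a) f = trans (∑-cong λ i → cong (λ b → when b (f (suc i))) (does-suc i))
                                     (∑-single a (f ∘ suc))
    where
    does-suc : ∀ i → does (suc i ≟ suc a) ≡ does (i ≟ a)
    does-suc i with i ≟ a
    ... | yes _ = refl
    ... | no  _ = refl

  listSum≡∑ : ∀ {n} (f : Vector ℕ n) → ListAction.sum (List.map f (List.allFin n)) ≡ ∑ f
  listSum≡∑ f = trans (cong ListAction.sum (map-tabulate id f)) (sum-tabulate f)
    where
    sum-tabulate : ∀ {n} (f : Vector ℕ n) → ListAction.sum (List.tabulate f) ≡ ∑ f
    sum-tabulate {zero}  f = refl
    sum-tabulate {suc n} f = cong (f zero +_) (sum-tabulate (f ∘ suc))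

∑∑-cong : ∀ {m n} {f g : Fin m → Fin n → ℕ} → (∀ i j → f i j ≡ g i j) →
          ∑ (λ i → ∑ (f i)) ≡ ∑ (λ i → ∑ (g i))
∑∑-cong f≗g = ∑-cong λ i → ∑-cong (f≗g i)

∑∑-distrib-+ : ∀ {m n} (f g : Fin m → Fin n → ℕ) →
               ∑ (λ i → ∑ λ j → f i j + g i j) ≡ ∑ (λ i → ∑ (f i)) + ∑ (λ i → ∑ (g i))
∑∑-distrib-+ f g = trans (∑-cong λ i → ∑-distrib-+ (f i) (g i))
                         (∑-distrib-+ (λ i → ∑ (f i)) (λ i → ∑ (g i)))

-- Weights, degrees and edge counts.

-- Degrees, edge counts and cut sizes are all weights for suitable f; an edge {u, v} contributes f u v + f v u.
weight : ∀ {n} → Graph n → (Fin n → Fin n → ℕ) → ℕ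
weight G f = ∑ λ p → ∑ λ q → when (adj G p q) (f p q)

weight-cong : ∀ {n} (G : Graph n) {f g : Fin n → Fin n → ℕ} → (∀ p q → f p q ≡ g p q) →
              weight G f ≡ weight G g
weight-cong G f≗g = ∑∑-cong λ p q → cong (when (adj G p q)) (f≗g p q)

weight-+ : ∀ {n} (G : Graph n) (f g : Fin n → Fin n → ℕ) →
           weight G (λ p q → f p q + g p q) ≡ weight G f + weight G g
weight-+ G f g = trans (∑∑-cong λ p q → when-+ (adj G p q) (f p q) (g p q))
                       (∑∑-distrib-+ _ _)

weight-mono : ∀ {n} {H G : Graph n} {f g : Fin n → Fin n → ℕ} → H ⊆E G →
              (∀ p q → adj H p q ≡ true → f p q ≤ g p q) → weight H f ≤ weight G g
weight-mono {H = H} {G} {f} {g} H⊆G f≤g = ∑-mono λ p → ∑-mono λ q → entry p q (adj H p q) refl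
  where
  entry : ∀ p q b → adj H p q ≡ b → when b (f p q) ≤ when (adj G p q) (g p q)
  entry p q false _ = z≤n
  entry p q true  h = subst (λ b → f p q ≤ when b (g p q)) (≡.sym (H⊆G p q h)) (f≤g p q h)

weight-monoʳ : ∀ {n} (G : Graph n) {f g : Fin n → Fin n → ℕ} → (∀ p q → f p q ≤ g p q) →
               weight G f ≤ weight G g
weight-monoʳ G f≤g = weight-mono {H = G} {G} (λ _ _ → id) (λ p q _ → f≤g p q)

weight-transpose : ∀ {n} (G : Graph n) (f : Fin n → Fin n → ℕ) → weight G (flip f) ≡ weight G f
weight-transpose G f = trans (∑-comm _)
  (∑∑-cong λ p q → cong (λ b → when b (f p q)) (sym G q p))

at : ∀ {n} → Fin n → Fin n → Fin n → ℕ
at v p _ = ind (does (p ≟ v))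

deg≡∑ : ∀ {n} (G : Graph n) v → deg G v ≡ ∑ (λ q → ind (adj G v q))
deg≡∑ G v = listSum≡∑ _

deg≡weight : ∀ {n} (G : Graph n) v → deg G v ≡ weight G (at v)
deg≡weight G v = trans (deg≡∑ G v) (≡.sym (trans
  (∑-cong λ p → trans (∑-cong λ q → when-comm (adj G p q) (does (p ≟ v)) 1)
                          (∑-when (does (p ≟ v)) _))
  (∑-single v _)))

-- Orients each edge towards its larger end, so that it is counted once.
forward : ∀ {n} → Fin n → Fin n → ℕ
forward p q = ind (does (toℕ p <? toℕ q))

edgeCount≡weight : ∀ {n} (G : Graph n) → edgeCount G ≡ weight G forward
edgeCount≡weight G = trans (listSum≡∑ _) (∑-cong λ p → trans (listSum≡∑ _)
  (∑-cong λ q → ind-∧ (adj G p q) _))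

forward-total : ∀ {n} {p q : Fin n} → p ≢ q → forward p q + forward q p ≡ 1
forward-total {p = p} {q} p≢q with <-cmp (toℕ p) (toℕ q)
... | tri< p<q _ p≯q = cong₂ (λ a b → ind a + ind b) (dec-true (_ <? _) p<q) (dec-false (_ <? _) p≯q)
... | tri≈ _ p≡q _   = contradiction (toℕ-injective p≡q) p≢q
... | tri> p≮q _ p>q = cong₂ (λ a b → ind a + ind b) (dec-false (_ <? _) p≮q) (dec-true (_ <? _) p>q)

adj⇒≢ : ∀ {n} (G : Graph n) {p q} → adj G p q ≡ true → p ≢ q
adj⇒≢ G {p} e refl = clash e (irrefl G p)

adj-sym : ∀ {n} (G : Graph n) {p q} → adj G p q ≡ true → adj G q p ≡ true
adj-sym G {p} {q} e = trans (sym G q p) e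

-- Transposing the backward half of the weight moves it onto forward pairs, where each edge then
-- carries `f p q + f q p`, which is at most 1.
weight≤edgeCount : ∀ {n} (G : Graph n) (f : Fin n → Fin n → ℕ) →
                       (∀ p q → f p q + f q p ≤ 1) → weight G f ≤ edgeCount G
weight≤edgeCount G f f≤1 = begin
  weight G f
    ≤⟨ weight-mono {H = G} {G} (λ _ _ → id) split ⟩
  weight G (λ p q → when′ p q (f p q) + when′ q p (f p q))
    ≡⟨ weight-+ G _ _ ⟩
  weight G (λ p q → when′ p q (f p q)) + weight G (λ p q → when′ q p (f p q))
    ≡⟨ cong (weight G (λ p q → when′ p q (f p q)) +_) (weight-transpose G _) ⟨
  weight G (λ p q → when′ p q (f p q)) + weight G (λ p q → when′ p q (f q p))
    ≡⟨ weight-+ G _ _ ⟨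
  weight G (λ p q → when′ p q (f p q) + when′ p q (f q p))
    ≤⟨ weight-monoʳ G (λ p q → ≤-trans (≤-reflexive (≡.sym (when-+ (lt p q) (f p q) (f q p))))
                                      (when-mono (lt p q) (f≤1 p q))) ⟩
  weight G forward
    ≡⟨ edgeCount≡weight G ⟨
  edgeCount G ∎
  where
  open ≤-Reasoning
  lt : ∀ {n} → Fin n → Fin n → Bool
  lt p q = does (toℕ p <? toℕ q)
  when′ : ∀ {n} → Fin n → Fin n → ℕ → ℕ
  when′ p q = when (lt p q)
  when-mono : ∀ b {k m} → k ≤ m → when b k ≤ when b m
  when-mono true  k≤m = k≤m
  when-mono false _   = z≤n
  split : ∀ p q → adj G p q ≡ true → f p q ≤ when′ p q (f p q) + when′ q p (f p q)
  split p q e = go (lt p q) (lt q p) (forward-total (adj⇒≢ G e))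
    where
    go : ∀ a b → ind a + ind b ≡ 1 → f p q ≤ when a (f p q) + when b (f p q)
    go true  b    _ = m≤m+n _ _
    go false true _ = ≤-refl

-- Exactly one of the two directions of an edge is forward, so `forward` and its transpose together
-- count every adjacent ordered pair once.
handshake : ∀ {n} (G : Graph n) → edgeCount G + edgeCount G ≡ ∑ (deg G)
handshake G = begin
  edgeCount G + edgeCount G
    ≡⟨ cong₂ _+_ (edgeCount≡weight G) (trans (edgeCount≡weight G) (≡.sym (weight-transpose G forward))) ⟩
  weight G forward + weight G (flip forward)
    ≡⟨ weight-+ G _ _ ⟨
  weight G (λ p q → forward p q + forward q p)
    ≡⟨ ∑∑-cong (λ p q → entry p q (adj G p q) refl) ⟩
  weight G (λ _ _ → 1)
    ≡⟨ ∑-cong (deg≡∑ G) ⟨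
  ∑ (deg G) ∎
  where
  open ≡-Reasoning
  entry : ∀ p q b → adj G p q ≡ b → when b (forward p q + forward q p) ≡ when b 1
  entry p q true  e = forward-total (adj⇒≢ G e)
  entry p q false _ = refl

-- Boundaries of vertex sets.

boundary : ∀ {n} → (Fin n → Bool) → Fin n → Fin n → ℕ
boundary S p q = ind (S p ∧ not (S q))

cut : ∀ {n} → Graph n → (Fin n → Bool) → ℕ
cut G S = weight G (boundary S)

cut-cong : ∀ {n} (G : Graph n) {S T : Fin n → Bool} → S ≗ T → cut G S ≡ cut G T
cut-cong G S≗T = weight-cong G λ p q → cong₂ (λ a b → ind (a ∧ not b)) (S≗T p) (S≗T q)

cut-complement : ∀ {n} (G : Graph n) S → cut G (not ∘ S) ≡ cut G S
cut-complement G S = trans (weight-cong G λ p q → entry (S p) (S q)) (weight-transpose G (boundary S))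
  where
  entry : ∀ a b → ind (not a ∧ not (not b)) ≡ ind (b ∧ not a)
  entry true  true  = refl
  entry true  false = refl
  entry false true  = refl
  entry false false = refl

entry≤weight : ∀ {n} (G : Graph n) (f : Fin n → Fin n → ℕ) {p q} → adj G p q ≡ true → f p q ≤ weight G f
entry≤weight G f {p} {q} e = subst (λ b → when b (f p q) ≤ weight G f) e
  (≤-trans (term≤∑ _ q) (term≤∑ (λ p → ∑ λ q → when (adj G p q) (f p q)) p))

zero-cut-closed : ∀ {n} (G : Graph n) S {p q} → cut G S ≡ 0 → S p ≡ true → adj G p q ≡ true → S q ≡ true
zero-cut-closed G S {p} {q} c≡0 Sp e with S q in Sq
... | true  = refl
... | false = contradiction
  (subst₂ (λ a b → ind (a ∧ not b) ≤ 0) Sp Sq (subst (boundary S p q ≤_) c≡0 (entry≤weight G _ e)))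
  λ ()
  where open ≡ using (subst₂)

weight-positive : ∀ {n} (G : Graph n) f → 1 ≤ weight G f → ∃[ p ] ∃[ q ] adj G p q ≡ true
weight-positive G f 1≤w =
  let p , 1≤p = ∑-positive _ 1≤w
      q , 1≤q = ∑-positive _ 1≤p
  in p , q , positive⇒true 1≤q
  where
  positive⇒true : ∀ {b k} → 1 ≤ when b k → b ≡ true
  positive⇒true {true} _ = refl

neighbour : ∀ {n} (G : Graph n) v → 1 ≤ deg G v → ∃[ w ] adj G v w ≡ true
neighbour G v 1≤d with ∑-positive _ (subst (1 ≤_) (deg≡∑ G v) 1≤d)
... | w , 1≤ with adj G v w in e
...   | true  = w , e
...   | false = contradiction 1≤ λ ()

-- Single edges, unions, differences and exchanges of edge sets.

edge : ∀ {n} (a b : Fin n) → a ≢ b → Graph n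
edge a b a≢b = record
  { adj    = λ p q → (does (p ≟ a) ∧ does (q ≟ b)) ∨ (does (p ≟ b) ∧ does (q ≟ a))
  ; sym    = λ p q → trans (∨-comm (does (p ≟ a) ∧ does (q ≟ b)) _)
                           (cong₂ _∨_ (∧-comm (does (p ≟ b)) _) (∧-comm (does (p ≟ a)) _))
  ; irrefl = loop }
  where
  loop : ∀ v → (does (v ≟ a) ∧ does (v ≟ b)) ∨ (does (v ≟ b) ∧ does (v ≟ a)) ≡ false
  loop v with v ≟ a | v ≟ b
  ... | yes refl | yes refl = contradiction refl a≢b
  ... | yes _    | no  _    = refl
  ... | no  _    | yes _    = refl
  ... | no  _    | no  _    = refl

edge⁻ : ∀ {n} {a b : Fin n} a≢b {p q} → adj (edge a b a≢b) p q ≡ true →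
        (p ≡ a × q ≡ b) ⊎ (p ≡ b × q ≡ a)
edge⁻ {a = a} {b} _ {p} {q} e with ∨-true⁻ {does (p ≟ a) ∧ does (q ≟ b)} e
... | inj₁ h = inj₁ (does⁻ (∧-trueˡ h) , does⁻ (∧-trueʳ {does (p ≟ a)} h))
... | inj₂ h = inj₂ (does⁻ (∧-trueˡ h) , does⁻ (∧-trueʳ {does (p ≟ b)} h))

weight-edge : ∀ {n} {a b : Fin n} a≢b f → weight (edge a b a≢b) f ≡ f a b + f b a
weight-edge {n} {a} {b} a≢b f = begin
  weight (edge a b a≢b) f
    ≡⟨ ∑∑-cong split ⟩
  ∑ (λ p → ∑ λ q → single a b p q + single b a p q)
    ≡⟨ ∑∑-distrib-+ (single a b) (single b a) ⟩
  ∑ (λ p → ∑ (single a b p)) + ∑ (λ p → ∑ (single b a p))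
    ≡⟨ cong₂ _+_ (∑∑-single a b) (∑∑-single b a) ⟩
  f a b + f b a ∎
  where
  open ≡-Reasoning
  single : Fin n → Fin n → Fin n → Fin n → ℕ
  single c d p q = when (does (p ≟ c)) (when (does (q ≟ d)) (f p q))
  ∑∑-single : ∀ c d → ∑ (λ p → ∑ (single c d p)) ≡ f c d
  ∑∑-single c d = trans (∑-cong λ p → ∑-when (does (p ≟ c)) _)
                        (trans (∑-single c _) (∑-single d _))
  split : ∀ p q → when (adj (edge a b a≢b) p q) (f p q) ≡ single a b p q + single b a p q
  split p q with p ≟ a | p ≟ b
  ... | yes refl | yes refl = contradiction refl a≢b
  ... | no  _    | no  _    = refl
  ... | no  _    | yes _    = refl
  ... | yes _    | no  _    with does (q ≟ b)
  ...   | true  = ≡.sym (+-identityʳ _)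
  ...   | false = refl

infixl 6 _∪E_

_∪E_ : ∀ {n} → Graph n → Graph n → Graph n
G ∪E H = record
  { adj    = λ p q → adj G p q ∨ adj H p q
  ; sym    = λ p q → cong₂ _∨_ (sym G p q) (sym H p q)
  ; irrefl = λ v → cong₂ _∨_ (irrefl G v) (irrefl H v) }

∪E⁻ : ∀ {n} (G H : Graph n) {p q} → adj (G ∪E H) p q ≡ true → adj G p q ≡ true ⊎ adj H p q ≡ true
∪E⁻ G H = ∨-true⁻

⊆E-∪ˡ : ∀ {n} (G H : Graph n) → G ⊆E (G ∪E H)
⊆E-∪ˡ G H p q = ∨-trueˡ

⊆E-∪ʳ : ∀ {n} (G H : Graph n) → H ⊆E (G ∪E H)
⊆E-∪ʳ G H p q = ∨-trueʳ

edge-⊆E : ∀ {n} (G : Graph n) {a b} a≢b → adj G a b ≡ true → edge a b a≢b ⊆E G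
edge-⊆E G a≢b e p q h with edge⁻ a≢b {p} {q} h
... | inj₁ (refl , refl) = e
... | inj₂ (refl , refl) = adj-sym G e

∪-⊆E : ∀ {n} {A B G : Graph n} → A ⊆E G → B ⊆E G → (A ∪E B) ⊆E G
∪-⊆E {A = A} {B} A⊆G B⊆G p q h = [ A⊆G p q , B⊆G p q ]′ (∪E⁻ A B h)

Disjoint : ∀ {n} → Graph n → Graph n → Set
Disjoint A B = ∀ p q → adj A p q ≡ true → adj B p q ≡ false

Disjoint-sym : ∀ {n} {A B : Graph n} → Disjoint A B → Disjoint B A
Disjoint-sym A⊥B p q b = ¬-not λ a → clash b (A⊥B p q a)

∪-Disjoint : ∀ {n} {A B C : Graph n} → Disjoint A C → Disjoint B C → Disjoint (A ∪E B) C
∪-Disjoint {A = A} {B} A⊥C B⊥C p q h = [ A⊥C p q , B⊥C p q ]′ (∪E⁻ A B h)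

Disjoint-∪ : ∀ {n} {A B C : Graph n} → Disjoint A B → Disjoint A C → Disjoint A (B ∪E C)
Disjoint-∪ A⊥B A⊥C p q a = cong₂ _∨_ (A⊥B p q a) (A⊥C p q a)

edge-Disjoint : ∀ {n} (G : Graph n) {a b} a≢b → adj G a b ≡ false → Disjoint (edge a b a≢b) G
edge-Disjoint G {a} {b} a≢b e p q h with edge⁻ a≢b {p} {q} h
... | inj₁ (refl , refl) = e
... | inj₂ (refl , refl) = trans (sym G b a) e

edges-Disjoint : ∀ {n} {a b c d : Fin n} a≢b c≢d → a ≢ c → a ≢ d → Disjoint (edge a b a≢b) (edge c d c≢d)
edges-Disjoint a≢b c≢d a≢c a≢d = edge-Disjoint (edge _ _ c≢d) a≢b
  (cong₂ (λ x y → (x ∧ _) ∨ (y ∧ _)) (dec-false (_ ≟ _) a≢c) (dec-false (_ ≟ _) a≢d))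

weight-∪ : ∀ {n} {A B : Graph n} → Disjoint A B → ∀ f → weight (A ∪E B) f ≡ weight A f + weight B f
weight-∪ {A = A} {B} A⊥B f = trans (∑∑-cong λ p q → entry p q (adj A p q) refl) (∑∑-distrib-+ _ _)
  where
  entry : ∀ p q b → adj A p q ≡ b →
          when (b ∨ adj B p q) (f p q) ≡ when b (f p q) + when (adj B p q) (f p q)
  entry p q true  a rewrite A⊥B p q a = ≡.sym (+-identityʳ _)
  entry p q false _ = refl

∖E⁻ : ∀ {n} (G H : Graph n) {p q} → adj (G ∖E H) p q ≡ true → adj G p q ≡ true × adj H p q ≡ false
∖E⁻ G H {p} {q} e = ∧-trueˡ e , not-true (∧-trueʳ {adj G p q} e)
  where
  not-true : ∀ {b} → not b ≡ true → b ≡ false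
  not-true {false} _ = refl

weight-∖ : ∀ {n} {H G : Graph n} → H ⊆E G → ∀ f → weight (G ∖E H) f + weight H f ≡ weight G f
weight-∖ {H = H} {G} H⊆G f = trans (≡.sym (∑∑-distrib-+ _ _)) (∑∑-cong λ p q → entry p q (adj H p q) refl)
  where
  entry : ∀ p q b → adj H p q ≡ b →
          when (adj G p q ∧ not b) (f p q) + when b (f p q) ≡ when (adj G p q) (f p q)
  entry p q true  h rewrite H⊆G p q h = refl
  entry p q false _ with adj G p q
  ... | true  = +-identityʳ _
  ... | false = refl

exchange : ∀ {n} → Graph n → Graph n → Graph n → Graph n
exchange G D N = (G ∖E D) ∪E N

-- Stated additively to avoid truncated subtraction. Taking `at v` for f gives the effect on
-- degrees, taking `boundary S` the effect on boundaries.
weight-exchange : ∀ {n} {G D N : Graph n} → D ⊆E G → Disjoint N G → ∀ f →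
                  weight (exchange G D N) f + weight D f ≡ weight G f + weight N f
weight-exchange {G = G} {D} {N} D⊆G N⊥G f = begin
  weight (exchange G D N) f + weight D f
    ≡⟨ cong (_+ weight D f) (weight-∪ {A = G ∖E D} {N} G∖D⊥N f) ⟩
  weight (G ∖E D) f + weight N f + weight D f
    ≡⟨ rearrange (weight (G ∖E D) f) (weight N f) (weight D f) ⟩
  weight (G ∖E D) f + weight D f + weight N f
    ≡⟨ cong (_+ weight N f) (weight-∖ {H = D} {G} D⊆G f) ⟩
  weight G f + weight N f ∎
  where
  open ≡-Reasoning
  rearrange : ∀ a b c → a + b + c ≡ a + c + b
  rearrange = solve-∀
  G∖D⊥N : Disjoint (G ∖E D) N
  G∖D⊥N p q e = Disjoint-sym {A = N} {G} N⊥G p q (proj₁ (∖E⁻ G D e))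

-- Searching and summing over all vertex sets.

infixr 5 _▹_

_▹_ : ∀ {n} → Bool → (Fin n → Bool) → Fin (suc n) → Bool
(b ▹ S) zero    = b
(b ▹ S) (suc i) = S i

▹-cong : ∀ {n b} {S T : Fin n → Bool} → S ≗ T → (b ▹ S) ≗ (b ▹ T)
▹-cong S≗T zero    = refl
▹-cong S≗T (suc i) = S≗T i

-- The search builds sets with `▹`. A given set is recovered from its head and tail only up to `≗`,
-- so P has to respect `≗`.
∃-subset? : ∀ {n} {P : (Fin n → Bool) → Set} → (∀ {S T} → S ≗ T → P S → P T) → Decidable P → Dec (∃ P)
∃-subset? {zero} resp P? = map′ (_ ,_) (λ { (S , p) → resp (λ ()) p }) (P? λ ())
∃-subset? {suc n} {P} resp P? =
  map′ [ extend true , extend false ]′ restrict (with-head true ⊎-dec with-head false)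
  where
  with-head : ∀ b → Dec (∃ λ S → P (b ▹ S))
  with-head b = ∃-subset? (λ S≗T → resp (▹-cong S≗T)) (λ S → P? (b ▹ S))
  extend : ∀ b → (∃ λ S → P (b ▹ S)) → ∃ P
  extend b (S , p) = b ▹ S , p
  restrict : ∃ P → (∃ λ S → P (true ▹ S)) ⊎ (∃ λ S → P (false ▹ S))
  restrict (S , p) with S zero in S0
  ... | true  = inj₁ (S ∘ suc , resp (λ { zero → S0 ; (suc i) → refl }) p)
  ... | false = inj₂ (S ∘ suc , resp (λ { zero → S0 ; (suc i) → refl }) p)

-- The term of a sum over sets that belongs to a given X can be located only if the summand respects
-- `≗`.
Extensional : ∀ {n} → ((Fin n → Bool) → ℕ) → Set
Extensional f = ∀ {S T} → S ≗ T → f S ≡ f T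

cut-extensional : ∀ {n} (G : Graph n) t → Extensional (λ S → t ∸ cut G S)
cut-extensional G t S≗T = cong (t ∸_) (cut-cong G S≗T)

▹-extensional : ∀ {n} {f : (Fin (suc n) → Bool) → ℕ} → Extensional f → ∀ b → Extensional (λ S → f (b ▹ S))
▹-extensional ext b S≗T = ext (▹-cong S≗T)

▹-η : ∀ {n} (S : Fin (suc n) → Bool) {b} → S zero ≡ b → (b ▹ (S ∘ suc)) ≗ S
▹-η S S0 zero    = ≡.sym S0
▹-η S S0 (suc i) = refl

∑ˢ : ∀ n → ((Fin n → Bool) → ℕ) → ℕ
∑ˢ zero    f = f λ ()
∑ˢ (suc n) f = ∑ˢ n (λ S → f (true ▹ S)) + ∑ˢ n (λ S → f (false ▹ S))

∑ˢ-mono : ∀ n {f g : (Fin n → Bool) → ℕ} → (∀ S → f S ≤ g S) → ∑ˢ n f ≤ ∑ˢ n g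
∑ˢ-mono zero    f≤g = f≤g _
∑ˢ-mono (suc n) f≤g = +-mono-≤ (∑ˢ-mono n λ S → f≤g _) (∑ˢ-mono n λ S → f≤g _)

∑ˢ-mono-< : ∀ n {f g : (Fin n → Bool) → ℕ} → Extensional f → Extensional g → ∀ X →
            (∀ S → f S ≤ g S) → f X < g X → ∑ˢ n f < ∑ˢ n g
∑ˢ-mono-< zero extf extg X f≤g fX<gX =
  subst₂ _<_ (extf λ ()) (extg λ ()) fX<gX
  where open ≡ using (subst₂)
∑ˢ-mono-< (suc n) extf extg X f≤g fX<gX with X zero in X0
... | true  = +-mono-<-≤ (∑ˢ-mono-< n (▹-extensional extf true) (▹-extensional extg true) (X ∘ suc) (λ S → f≤g _)
                            (subst₂ _<_ (≡.sym (extf (▹-η X X0))) (≡.sym (extg (▹-η X X0))) fX<gX))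
                         (∑ˢ-mono n λ S → f≤g _)
  where open ≡ using (subst₂)
... | false = +-mono-≤-< (∑ˢ-mono n λ S → f≤g _)
                         (∑ˢ-mono-< n (▹-extensional extf false) (▹-extensional extg false) (X ∘ suc) (λ S → f≤g _)
                            (subst₂ _<_ (≡.sym (extf (▹-η X X0))) (≡.sym (extg (▹-η X X0))) fX<gX))
  where open ≡ using (subst₂)

∑ˢ-term : ∀ n {f : (Fin n → Bool) → ℕ} → Extensional f → ∀ X → f X ≤ ∑ˢ n f
∑ˢ-term zero    ext X = ≤-reflexive (ext λ ())
∑ˢ-term (suc n) ext X with X zero in X0
... | true  = ≤-trans (≤-reflexive (≡.sym (ext (▹-η X X0))))
                      (≤-trans (∑ˢ-term n (▹-extensional ext true) (X ∘ suc)) (m≤m+n _ _))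
... | false = ≤-trans (≤-reflexive (≡.sym (ext (▹-η X X0))))
                      (≤-trans (∑ˢ-term n (▹-extensional ext false) (X ∘ suc)) (m≤n+m _ _))

+-interchange : ∀ a b c d → (a + b) + (c + d) ≡ (a + c) + (b + d)
+-interchange = solve-∀

∑ˢ-distrib-+ : ∀ n (f g : (Fin n → Bool) → ℕ) → ∑ˢ n (λ S → f S + g S) ≡ ∑ˢ n f + ∑ˢ n g
∑ˢ-distrib-+ zero    f g = refl
∑ˢ-distrib-+ (suc n) f g = trans
  (cong₂ _+_ (∑ˢ-distrib-+ n (λ S → f (true ▹ S)) (λ S → g (true ▹ S)))
             (∑ˢ-distrib-+ n (λ S → f (false ▹ S)) (λ S → g (false ▹ S))))
  (+-interchange (∑ˢ n λ S → f (true ▹ S)) (∑ˢ n λ S → g (true ▹ S))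
                 (∑ˢ n λ S → f (false ▹ S)) (∑ˢ n λ S → g (false ▹ S)))

∑ˢ-cong : ∀ n {f g : (Fin n → Bool) → ℕ} → (∀ S → f S ≡ g S) → ∑ˢ n f ≡ ∑ˢ n g
∑ˢ-cong zero    f≗g = f≗g _
∑ˢ-cong (suc n) f≗g = cong₂ _+_ (∑ˢ-cong n λ S → f≗g _) (∑ˢ-cong n λ S → f≗g _)

∑ˢ≤2^ : ∀ n {f : (Fin n → Bool) → ℕ} → (∀ S → f S ≤ 1) → ∑ˢ n f ≤ 2 ^ n
∑ˢ≤2^ zero    f≤1 = f≤1 _
∑ˢ≤2^ (suc n) f≤1 = +-mono-≤ (∑ˢ≤2^ n λ S → f≤1 _)
                             (≤-trans (∑ˢ≤2^ n λ S → f≤1 _) (m≤m+n (2 ^ n) 0))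

_△_ : ∀ {n} → (Fin n → Bool) → (Fin n → Bool) → Fin n → Bool
(S △ T) p = S p xor T p

-- Symmetric difference with X permutes the vertex sets: at each vertex it either swaps the two
-- halves of the sum or keeps them.
∑ˢ-△ : ∀ n {f : (Fin n → Bool) → ℕ} → Extensional f → ∀ X → ∑ˢ n (λ S → f (X △ S)) ≡ ∑ˢ n f
∑ˢ-△ zero    ext X = ext λ ()
∑ˢ-△ (suc n) {f} ext X = begin
  ∑ˢ (suc n) (λ S → f (X △ S))
    ≡⟨ cong₂ _+_ (∑ˢ-cong n λ S → ext (△-▹ true S)) (∑ˢ-cong n λ S → ext (△-▹ false S)) ⟩
  half (X zero xor true) + half (X zero xor false)
    ≡⟨ swap-halves (X zero) ⟩
  half true + half false
    ≡⟨⟩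
  ∑ˢ n (λ S → f (true ▹ ((X ∘ suc) △ S))) + ∑ˢ n (λ S → f (false ▹ ((X ∘ suc) △ S)))
    ≡⟨ cong₂ _+_ (∑ˢ-△ n (▹-extensional ext true) (X ∘ suc)) (∑ˢ-△ n (▹-extensional ext false) (X ∘ suc)) ⟩
  ∑ˢ (suc n) f ∎
  where
  open ≡-Reasoning
  half : Bool → ℕ
  half b = ∑ˢ n λ S → f (b ▹ ((X ∘ suc) △ S))
  △-▹ : ∀ b S → (X △ (b ▹ S)) ≗ ((X zero xor b) ▹ ((X ∘ suc) △ S))
  △-▹ b S zero    = refl
  △-▹ b S (suc i) = refl
  swap-halves : ∀ b → half (b xor true) + half (b xor false) ≡ half true + half false
  swap-halves true  = +-comm (half false) (half true)
  swap-halves false = refl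

_⊊_ : ∀ {n} → (Fin n → Bool) → (Fin n → Bool) → Set
T ⊊ X = (∀ p → T p ≡ true → X p ≡ true) × ∃[ p ] (X p ≡ true × T p ≡ false)

_⊊?_ : ∀ {n} (T X : Fin n → Bool) → Dec (T ⊊ X)
T ⊊? X = all? (λ p → (T p Bool.≟ true) →-dec (X p Bool.≟ true))
         ×-dec any? (λ p → (X p Bool.≟ true) ×-dec (T p Bool.≟ false))

size : ∀ {n} → (Fin n → Bool) → ℕ
size S = ∑ (ind ∘ S)

size-⊊ : ∀ {n} {T X : Fin n → Bool} → T ⊊ X → size T < size X
size-⊊ {T = T} {X} (T⊆X , p , Xp , Tp) =
  ∑-mono-< p (λ q → entry q (T q) refl)
             (≤-reflexive (trans (cong (suc ∘ ind) Tp) (≡.sym (cong ind Xp))))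
  where
  entry : ∀ q b → T q ≡ b → ind b ≤ ind (X q)
  entry q true  e rewrite T⊆X q e = ≤-refl
  entry q false _ = z≤n

-- Passing to a smaller set with P terminates because `size` decreases.
minimal-subset : ∀ {n} {P : (Fin n → Bool) → Set} → (∀ {S T} → S ≗ T → P S → P T) → Decidable P →
                 ∃ P → ∃[ X ] (P X × (∀ T → T ⊊ X → ¬ P T))
minimal-subset {n} {P} resp P? (X , PX) = descend X PX (<-wellFounded (size X))
  where
  below-resp : ∀ {X S T} → S ≗ T → P S × S ⊊ X → P T × T ⊊ X
  below-resp S≗T (PS , S⊆X , p , Xp , Sp) =
    resp S≗T PS , (λ q Tq → S⊆X q (trans (S≗T q) Tq)) , p , Xp , trans (≡.sym (S≗T p)) Sp
  descend : ∀ X → P X → Acc _<_ (size X) → ∃[ X ] (P X × (∀ T → T ⊊ X → ¬ P T))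
  descend X PX (acc rec) with ∃-subset? (below-resp {X}) (λ T → P? T ×-dec T ⊊? X)
  ... | yes (T , PT , T⊊X) = descend T PT (rec (size-⊊ T⊊X))
  ... | no  none           = X , PX , λ T T⊊X PT → none (T , PT , T⊊X)

-- Edge-connectivity expressed by boundaries.

_⟶_ : ∀ {n} {G : Graph n} {u w v : Fin n} → Walk G u w → adj G w v ≡ true → Walk G u v
here     ⟶ e = step e here
step d p ⟶ e = step d (p ⟶ e)

-- Vertices are added one by one along edges leaving the set, each with its walk; the complement
-- shrinks every time. Closure means that the final set has no boundary.
reachable-set : ∀ {n} (G : Graph n) u → ∃[ S ] (S u ≡ true × (∀ w → S w ≡ true → Walk G u w) ×
                                               (∀ p q → S p ≡ true → adj G p q ≡ true → S q ≡ true))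
reachable-set {n} G u = grow (λ p → does (p ≟ u)) (dec-true (u ≟ u) refl)
                             (λ w e → subst (Walk G u) (≡.sym (does⁻ e)) here) (<-wellFounded _)
  where
  grow : ∀ S → S u ≡ true → (∀ w → S w ≡ true → Walk G u w) → Acc _<_ (size (not ∘ S)) →
         ∃[ S ] (S u ≡ true × (∀ w → S w ≡ true → Walk G u w) ×
                 (∀ p q → S p ≡ true → adj G p q ≡ true → S q ≡ true))
  grow S Su walks (acc rec)
    with any? (λ p → any? λ q → (S p Bool.≟ true) ×-dec (adj G p q Bool.≟ true) ×-dec (S q Bool.≟ false))
  ... | no closed = S , Su , walks , λ p q Sp e → case S q Bool.≟ false of λ
        { (yes Sq) → contradiction (p , q , Sp , e , Sq) closed
        ; (no Sq)  → ¬-not Sq }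
  ... | yes (p , q , Sp , e , Sq) = grow S⁺ (∨-trueʳ Su) walks⁺ (rec (size-⊊ shrinks))
    where
    S⁺ : Fin n → Bool
    S⁺ w = does (w ≟ q) ∨ S w
    walks⁺ : ∀ w → S⁺ w ≡ true → Walk G u w
    walks⁺ w h with ∨-true⁻ {does (w ≟ q)} h
    ... | inj₁ w≡q = subst (Walk G u) (≡.sym (does⁻ w≡q)) (walks p Sp ⟶ e)
    ... | inj₂ Sw  = walks w Sw
    shrinks : (not ∘ S⁺) ⊊ (not ∘ S)
    shrinks = (λ w h → drop (does (w ≟ q)) h) , q , cong not Sq , cong (λ b → not (b ∨ S q)) (dec-true (q ≟ q) refl)
      where
      drop : ∀ a {b} → not (a ∨ b) ≡ true → not b ≡ true
      drop false h = h

closed⇒cut≡0 : ∀ {n} (G : Graph n) S → (∀ p q → S p ≡ true → adj G p q ≡ true → S q ≡ true) → cut G S ≡ 0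
closed⇒cut≡0 {n} G S closed = n≤0⇒n≡0 (begin
  cut G S
    ≤⟨ weight-mono {H = G} {G} (λ _ _ → id) (λ p q e → entry p q (S p) refl e) ⟩
  weight G (λ _ _ → 0)
    ≡⟨ ∑∑-cong (λ p q → when-0 (adj G p q)) ⟩
  ∑ {n} (λ _ → ∑ {n} λ _ → 0)
    ≡⟨ trans (∑-cong λ _ → ∑-0 n) (∑-0 n) ⟩
  0 ∎)
  where
  open ≤-Reasoning
  entry : ∀ p q b → S p ≡ b → adj G p q ≡ true → ind (b ∧ not (S q)) ≤ 0
  entry p q true  Sp e rewrite closed p q Sp e = z≤n
  entry p q false _  _ = z≤n

cut≤edgeCount : ∀ {n} (G : Graph n) S → cut G S ≤ edgeCount G
cut≤edgeCount G S = weight≤edgeCount G _ λ p q → entry (S p) (S q)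
  where
  entry : ∀ a b → ind (a ∧ not b) + ind (b ∧ not a) ≤ 1
  entry true  true  = z≤n
  entry true  false = ≤-refl
  entry false true  = ≤-refl
  entry false false = z≤n

-- The set reachable from u after deleting F has no boundary left, so its boundary in G lies in F
-- and has fewer than t edges. Hence it cannot miss v.
cuts⇒EdgeConnected : ∀ {n} (G : Graph n) t → (∀ S {p q} → S p ≡ true → S q ≡ false → t ≤ cut G S) → EdgeConnected t G
cuts⇒EdgeConnected G t t≤cut F F⊆G F<t u v
  with S , Su , walks , closed ← reachable-set (G ∖E F) u
  with S v in Sv
... | true  = walks v Sv
... | false = contradiction (t≤cut S Su Sv) (<⇒≱ (begin-strict
  cut G S                      ≡⟨ weight-∖ {H = F} {G} F⊆G _ ⟨
  cut (G ∖E F) S + cut F S     ≡⟨ cong (_+ cut F S) (closed⇒cut≡0 (G ∖E F) S closed) ⟩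
  cut F S                      ≤⟨ cut≤edgeCount F S ⟩
  edgeCount F                  <⟨ F<t ⟩
  t                            ∎))
  where open ≤-Reasoning

star : ∀ {n} → Graph n → Fin n → Graph n
star G v = record
  { adj    = λ p q → adj G p q ∧ (does (p ≟ v) ∨ does (q ≟ v))
  ; sym    = λ p q → cong₂ _∧_ (sym G p q) (∨-comm (does (p ≟ v)) _)
  ; irrefl = λ p → cong (_∧ _) (irrefl G p) }

-- Every edge of the star has v at one end. Transposing the pairs with v second puts v first, and an
-- edge at v is forward in only one direction.
edgeCount-star : ∀ {n} (G : Graph n) v → edgeCount (star G v) ≤ deg G v
edgeCount-star {n} G v = begin
  edgeCount (star G v)
    ≡⟨ edgeCount≡weight (star G v) ⟩
  weight (star G v) forward
    ≤⟨ weight-mono {H = star G v} {G} (λ _ _ → ∧-trueˡ)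
         (λ p q e → cover p q (does (p ≟ v)) (does (q ≟ v)) (∧-trueʳ {adj G p q} e)) ⟩
  weight G (λ p q → when (does (p ≟ v)) (forward p q) + when (does (q ≟ v)) (forward p q))
    ≡⟨ weight-+ G _ _ ⟩
  weight G (λ p q → when (does (p ≟ v)) (forward p q)) + weight G (λ p q → when (does (q ≟ v)) (forward p q))
    ≡⟨ cong (weight G (λ p q → when (does (p ≟ v)) (forward p q)) +_) (weight-transpose G _) ⟨
  weight G (λ p q → when (does (p ≟ v)) (forward p q)) + weight G (λ p q → when (does (p ≟ v)) (forward q p))
    ≡⟨ weight-+ G _ _ ⟨
  weight G (λ p q → when (does (p ≟ v)) (forward p q) + when (does (p ≟ v)) (forward q p))
    ≤⟨ weight-mono {H = G} {G} (λ _ _ → id) (λ p q e → merge p q (does (p ≟ v)) (adj⇒≢ G e)) ⟩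
  weight G (at v)
    ≡⟨ deg≡weight G v ⟨
  deg G v ∎
  where
  open ≤-Reasoning
  cover : ∀ (p q : Fin n) a b → a ∨ b ≡ true → forward p q ≤ when a (forward p q) + when b (forward p q)
  cover p q true  b    _ = m≤m+n _ _
  cover p q false true _ = ≤-refl
  merge : ∀ (p q : Fin n) a → p ≢ q → when a (forward p q) + when a (forward q p) ≤ ind a
  merge p q true  p≢q = ≤-reflexive (forward-total p≢q)
  merge p q false _   = z≤n

-- Deleting all edges at v isolates v. Positive degree supplies a second vertex that v can then no
-- longer reach.
¬EdgeConnected-suc-deg : ∀ {n} (G : Graph n) v → 1 ≤ deg G v → ¬ EdgeConnected (suc (deg G v)) G
¬EdgeConnected-suc-deg G v 1≤d conn with w , e ← neighbour G v 1≤d = isolated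
  (conn (star G v) (λ _ _ → ∧-trueˡ) (s≤s (edgeCount-star G v)) v w)
  where
  isolated : ¬ Walk (G ∖E star G v) v w
  isolated here       = adj⇒≢ G e refl
  isolated (step {w = z} h _) with ∖E⁻ G (star G v) {v} {z} h
  ... | vz , no-star = clash (cong₂ (λ a b → a ∧ (b ∨ does (z ≟ v))) vz (dec-true (v ≟ v) refl)) no-star

-- Interior vertices and minimal deficient sets.

Interior : ∀ {n} → Graph n → (Fin n → Bool) → Fin n → Set
Interior G X w = X w ≡ true × (∀ z → adj G w z ≡ true → X z ≡ true)

-- Otherwise every neighbour of x in X, like x itself, sends out an edge for each edge of x it accounts for,
-- so that ∂X has at least deg x edges.
interior-neighbour : ∀ {n} (G : Graph n) X {x} → X x ≡ true → cut G X < deg G x →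
                     ∃[ w ] (adj G x w ≡ true × Interior G X w)
interior-neighbour {n} G X {x} Xx small
  with any? (λ w → (adj G x w Bool.≟ true) ×-dec (X w Bool.≟ true) ×-dec
                   all? (λ z → (adj G w z Bool.≟ true) →-dec (X z Bool.≟ true)))
... | yes (w , e , Xw , inside) = w , e , Xw , inside
... | no none = contradiction small (≤⇒≯ (begin
  deg G x
    ≡⟨ deg≡∑ G x ⟩
  ∑ (λ q → ind (adj G x q))
    ≡⟨ ∑-cong (λ q → split (adj G x q) (X q)) ⟩
  ∑ (λ q → ind (adj G x q ∧ not (X q)) + ind (adj G x q ∧ X q))
    ≡⟨ ∑-distrib-+ (λ q → ind (adj G x q ∧ not (X q))) (λ q → ind (adj G x q ∧ X q)) ⟩
  out x + ∑ (λ q → ind (adj G x q ∧ X q))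
    ≡⟨ cong (_+ ∑ (λ q → ind (adj G x q ∧ X q))) (∑-single x out) ⟨
  ∑ (λ p → when (does (p ≟ x)) (out p)) + ∑ (λ p → ind (adj G x p ∧ X p))
    ≡⟨ ∑-distrib-+ (λ p → when (does (p ≟ x)) (out p)) (λ p → ind (adj G x p ∧ X p)) ⟨
  ∑ (λ p → when (does (p ≟ x)) (out p) + ind (adj G x p ∧ X p))
    ≤⟨ ∑-mono row ⟩
  cut G X ∎))
  where
  open ≤-Reasoning
  out : Fin n → ℕ
  out p = ∑ λ q → ind (adj G p q ∧ not (X q))
  split : ∀ a b → ind a ≡ ind (a ∧ not b) + ind (a ∧ b)
  split true  true  = refl
  split true  false = refl
  split false b     = refl
  out≡row : ∀ p → X p ≡ true → out p ≡ ∑ λ q → when (adj G p q) (boundary X p q)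
  out≡row p Xp = ∑-cong λ q → trans (ind-∧ (adj G p q) (not (X q)))
    (cong (λ b → when (adj G p q) (ind (b ∧ not (X q)))) (≡.sym Xp))
  exit : ∀ p → adj G x p ≡ true → X p ≡ true → 1 ≤ out p
  exit p e Xp with any? (λ z → (adj G p z Bool.≟ true) ×-dec (X z Bool.≟ false))
  ... | yes (z , pz , Xz) = subst (_≤ out p) (cong₂ (λ a b → ind (a ∧ not b)) pz Xz)
                                  (term≤∑ (λ q → ind (adj G p q ∧ not (X q))) z)
  ... | no inside = contradiction
    (p , e , Xp , λ z pz → ¬-not λ Xz → inside (z , pz , Xz)) none
  row : ∀ p → when (does (p ≟ x)) (out p) + ind (adj G x p ∧ X p) ≤ ∑ λ q → when (adj G p q) (boundary X p q)
  row p with p ≟ x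
  ... | yes refl rewrite irrefl G x = ≤-reflexive (trans (+-identityʳ _) (out≡row x Xx))
  ... | no _ with adj G x p in e | X p in Xp
  ...   | true  | true  = subst (1 ≤_)
    (trans (out≡row p Xp) (∑-cong λ q → cong (λ b → when (adj G p q) (ind (b ∧ not (X q)))) Xp)) (exit p e Xp)
  ...   | true  | false = z≤n
  ...   | false | _     = z≤n

_∩ˢ_ : ∀ {n} → (Fin n → Bool) → (Fin n → Bool) → Fin n → Bool
(X ∩ˢ S) p = X p ∧ S p

-- Counts the edges that join the two halves into which S splits X.
inner : ∀ {n} → (Fin n → Bool) → (Fin n → Bool) → Fin n → Fin n → ℕ
inner X S p q = ind ((X p ∧ S p) ∧ (X q ∧ not (S q)))

-- An edge leaving X leaves exactly one of the two halves; an edge between the halves leaves both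
-- and is counted twice.
cut-split : ∀ {n} (G : Graph n) X S →
            cut G (X ∩ˢ S) + cut G (X ∩ˢ (not ∘ S)) ≡ cut G X + (weight G (inner X S) + weight G (inner X S))
cut-split G X S = begin
  cut G (X ∩ˢ S) + cut G (X ∩ˢ (not ∘ S))
    ≡⟨ weight-+ G _ _ ⟨
  weight G (λ p q → boundary (X ∩ˢ S) p q + boundary (X ∩ˢ (not ∘ S)) p q)
    ≡⟨ weight-cong G (λ p q → entry (X p) (S p) (X q) (S q)) ⟩
  weight G (λ p q → boundary X p q + (inner X S p q + inner X S q p))
    ≡⟨ trans (weight-+ G _ _) (cong (cut G X +_) (weight-+ G _ _)) ⟩
  cut G X + (weight G (inner X S) + weight G (flip (inner X S)))
    ≡⟨ cong (λ k → cut G X + (weight G (inner X S) + k)) (weight-transpose G (inner X S)) ⟩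
  cut G X + (weight G (inner X S) + weight G (inner X S)) ∎
  where
  open ≡-Reasoning
  entry : ∀ xp sp xq sq →
          ind ((xp ∧ sp) ∧ not (xq ∧ sq)) + ind ((xp ∧ not sp) ∧ not (xq ∧ not sq)) ≡
          ind (xp ∧ not xq) + (ind ((xp ∧ sp) ∧ (xq ∧ not sq)) + ind ((xq ∧ sq) ∧ (xp ∧ not sp)))
  entry = toWitness {a? = ∀-bool? λ _ → ∀-bool? λ _ → ∀-bool? λ _ → ∀-bool? λ _ → _ ℕ.≟ _} _

-- Counts the boundary edges of S that run between X and Y.
cross : ∀ {n} → (Fin n → Bool) → (Fin n → Bool) → (Fin n → Bool) → Fin n → Fin n → ℕ
cross X Y S p q = ind ((S p ∧ not (S q)) ∧ ((X p ∧ Y q) ∨ (Y p ∧ X q)))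

-- As X and Y are disjoint, a boundary edge of S is of at most one of the three kinds: inside X,
-- inside Y, or between them.
cut-lower-bound : ∀ {n} (G : Graph n) X Y S → (∀ p → X p ∧ Y p ≡ false) →
                  weight G (inner X S) + weight G (inner Y S) + weight G (cross X Y S) ≤ cut G S
cut-lower-bound G X Y S disj = begin
  weight G (inner X S) + weight G (inner Y S) + weight G (cross X Y S)
    ≡⟨ trans (weight-+ G _ _) (cong (_+ weight G (cross X Y S)) (weight-+ G _ _)) ⟨
  weight G (λ p q → inner X S p q + inner Y S p q + cross X Y S p q)
    ≤⟨ weight-monoʳ G (λ p q → entry (X p) (Y p) (S p) (X q) (Y q) (S q) (disj p) (disj q)) ⟩
  cut G S ∎
  where
  open ≤-Reasoning
  entry : ∀ xp yp sp xq yq sq → xp ∧ yp ≡ false → xq ∧ yq ≡ false →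
          ind ((xp ∧ sp) ∧ (xq ∧ not sq)) + ind ((yp ∧ sp) ∧ (yq ∧ not sq))
            + ind ((sp ∧ not sq) ∧ ((xp ∧ yq) ∨ (yp ∧ xq))) ≤ ind (sp ∧ not sq)
  entry = toWitness {a? = ∀-bool? λ xp → ∀-bool? λ yp → ∀-bool? λ _ → ∀-bool? λ xq → ∀-bool? λ yq → ∀-bool? λ _ →
    (xp ∧ yp Bool.≟ false) →-dec (xq ∧ yq Bool.≟ false) →-dec (_ ≤? _)} _

Tight : ∀ {n} → Graph n → ℕ → (Fin n → Bool) → Set
Tight G t X = cut G X < t × (∀ T → T ⊊ X → ∃[ p ] T p ≡ true → t ≤ cut G T)

-- Both halves of X are nonempty and proper in X, so their boundaries sum to at least 4h, while
-- `cut G X` is below 2h. By `cut-split`, twice the number of inner edges then exceeds 2h.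
inner-bound : ∀ {n} (G : Graph n) h X S → Tight G (h + h) X → ∀ {p q} → X p ≡ true → X q ≡ true →
              S p ≡ true → S q ≡ false → suc h ≤ weight G (inner X S)
inner-bound G h X S (small , tight) {p} {q} Xp Xq Sp Sq = ≰⇒> λ i≤h → <⇒≱
  (+-mono-<-≤ small (+-mono-≤ i≤h i≤h))
  (subst (h + h + (h + h) ≤_) (cut-split G X S) (+-mono-≤
    (tight (X ∩ˢ S) ((λ _ → ∧-trueˡ) , q , Xq , cong₂ _∧_ Xq Sq) (p , cong₂ _∧_ Xp Sp))
    (tight (X ∩ˢ (not ∘ S)) ((λ _ → ∧-trueˡ) , p , Xp , cong₂ (λ a b → a ∧ not b) Xp Sp)
           (q , cong₂ (λ a b → a ∧ not b) Xq Sq))))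

-- h + h being even, the two halves of a tight set are joined by at least h + 1 edges, so a set splitting
-- two disjoint tight sets has a boundary two larger than required; this is what makes exchanges affordable.
separating-cut : ∀ {n} (G : Graph n) h X Y → (∀ p → X p ∧ Y p ≡ false) →
                 Tight G (h + h) X → Tight G (h + h) Y → ∀ S {p q r s} →
                 X p ≡ true → X q ≡ true → Y r ≡ true → Y s ≡ true →
                 S p ≡ true → S q ≡ false → S r ≡ true → S s ≡ false →
                 h + h + 2 + weight G (cross X Y S) ≤ cut G S
separating-cut G h X Y disj tightX tightY S Xp Xq Yr Ys Sp Sq Sr Ss =
  ≤-trans (+-monoˡ-≤ (weight G (cross X Y S)) (subst (_≤ weight G (inner X S) + weight G (inner Y S)) (double h)
            (+-mono-≤ (inner-bound G h X S tightX Xp Xq Sp Sq) (inner-bound G h Y S tightY Yr Ys Sr Ss))))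
          (cut-lower-bound G X Y S disj)
  where
  double : ∀ h → suc h + suc h ≡ h + h + 2
  double = solve-∀

-- Exchanges of edges that lower the potential.

Proper : ∀ {n l} → (Fin n → Fin l) → Graph n → Set
Proper c G = ∀ u v → adj G u v ≡ true → c u ≢ c v

edge-Proper : ∀ {n l} (c : Fin n → Fin l) {a b} a≢b → c a ≢ c b → Proper c (edge a b a≢b)
edge-Proper c a≢b ca≢cb p q h with edge⁻ a≢b {p} {q} h
... | inj₁ (refl , refl) = ca≢cb
... | inj₂ (refl , refl) = ca≢cb ∘ ≡.sym

∪-Proper : ∀ {n l} {c : Fin n → Fin l} {A B : Graph n} → Proper c A → Proper c B → Proper c (A ∪E B)
∪-Proper {A = A} {B} pA pB p q h = [ pA p q , pB p q ]′ (∪E⁻ A B h)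

-- Contribution to a boundary of one edge whose ends have memberships a and b.
sep : Bool → Bool → ℕ
sep a b = ind (a ∧ not b) + ind (b ∧ not a)

sep≤1 : ∀ a b → sep a b ≤ 1
sep≤1 = toWitness {a? = ∀-bool? λ _ → ∀-bool? λ _ → _ ≤? _} _

weight-∪₂ : ∀ {n} {A B : Graph n} {f k m} → Disjoint A B → weight A f ≡ k → weight B f ≡ m →
            weight (A ∪E B) f ≡ k + m
weight-∪₂ {A = A} {B} A⊥B wA wB = trans (weight-∪ {A = A} {B} A⊥B _) (cong₂ _+_ wA wB)

-- The empty and the full set have no boundary and contribute a constant t, which comparisons of
-- potentials do not see.
potential : ∀ {n} → ℕ → Graph n → ℕ
potential {n} t G = ∑ˢ n λ S → t ∸ cut G S

module Rewiring {n l} (F Z : Graph n) (c : Fin n → Fin l) (t : ℕ)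
                (Z⊥F : Disjoint Z F) (proper : Proper c Z) where

  G : Graph n
  G = F ∪E Z

  Z⊆G : Z ⊆E G
  Z⊆G = ⊆E-∪ʳ F Z

  record Improvement : Set where
    field
      Z⁺          : Graph n
      disjoint⁺   : Disjoint Z⁺ F
      proper⁺     : Proper c Z⁺
      same-deg    : ∀ v → deg Z⁺ v ≡ deg Z v
      improvement : potential t (F ∪E Z⁺) < potential t G

  ⊥G⇒⊥F : ∀ {N} → Disjoint N G → Disjoint N F
  ⊥G⇒⊥F N⊥G p q e = ¬-not λ f → clash (∨-trueˡ f) (N⊥G p q e)

  ⊥G⇒⊥Z : ∀ {N} → Disjoint N G → Disjoint N Z
  ⊥G⇒⊥Z N⊥G p q e = ¬-not λ z → clash (∨-trueʳ z) (N⊥G p q e)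

  -- For each S, either the boundary does not shrink or it still has t edges afterwards; in both
  -- cases its term does not grow. The term of X is positive before and gets strictly smaller.
  improve : ∀ (D N : Graph n) → D ⊆E Z → Disjoint N G → Proper c N →
            (∀ v → weight D (at v) ≡ weight N (at v)) →
            (∀ S → cut D S ≤ cut N S ⊎ t + cut D S ≤ cut G S + cut N S) →
            ∀ X → cut G X < t → cut D X < cut N X → Improvement
  improve D N D⊆Z N⊥G properN degs cuts X small gain = record
    { Z⁺          = Z⁺
    ; disjoint⁺   = Z⁺⊥F
    ; proper⁺     = λ p q h → case ∪E⁻ (Z ∖E D) N {p} {q} h of λ
        { (inj₁ z) → proper p q (∧-trueˡ z) ; (inj₂ m) → properN p q m }
    ; same-deg    = λ v → +-cancelʳ-≡ (weight D (at v)) (deg Z⁺ v) (deg Z v) (trans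
        (cong (_+ weight D (at v)) (deg≡weight Z⁺ v))
        (trans (weight-exchange {G = Z} {D} {N} D⊆Z N⊥Z (at v))
               (cong₂ _+_ (≡.sym (deg≡weight Z v)) (≡.sym (degs v)))))
    ; improvement = ∑ˢ-mono-< n (cut-extensional G⁺ t) (cut-extensional G t) X
        (λ S → deficit-≤ (balance S) (cuts S)) (deficit-< (balance X) gain small) }
    where
    Z⁺ = exchange Z D N
    G⁺ = F ∪E Z⁺
    N⊥Z : Disjoint N Z
    N⊥Z = ⊥G⇒⊥Z {N} N⊥G
    Z⁺⊥F : Disjoint Z⁺ F
    Z⁺⊥F = ∪-Disjoint {A = Z ∖E D} {N} {F} (λ p q h → Z⊥F p q (∧-trueˡ h)) (⊥G⇒⊥F {N} N⊥G)
    balance : ∀ S → cut G⁺ S + cut D S ≡ cut G S + cut N S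
    balance S = begin
      cut G⁺ S + cut D S
        ≡⟨ cong (_+ cut D S) (weight-∪ {A = F} {Z⁺} (Disjoint-sym {A = Z⁺} {F} Z⁺⊥F) _) ⟩
      cut F S + cut Z⁺ S + cut D S
        ≡⟨ +-assoc (cut F S) (cut Z⁺ S) (cut D S) ⟩
      cut F S + (cut Z⁺ S + cut D S)
        ≡⟨ cong (cut F S +_) (weight-exchange {G = Z} {D} {N} D⊆Z N⊥Z _) ⟩
      cut F S + (cut Z S + cut N S)
        ≡⟨ +-assoc (cut F S) (cut Z S) (cut N S) ⟨
      cut F S + cut Z S + cut N S
        ≡⟨ cong (_+ cut N S) (weight-∪ {A = F} {Z} (Disjoint-sym {A = Z} {F} Z⊥F) _) ⟨
      cut G S + cut N S ∎
      where open ≡-Reasoning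
    deficit-≤ : ∀ {a a⁺ d k} → a⁺ + d ≡ a + k → d ≤ k ⊎ t + d ≤ a + k → t ∸ a⁺ ≤ t ∸ a
    deficit-≤ {a} {a⁺} {d} {k} eq (inj₁ d≤k) = ∸-monoʳ-≤ t (+-cancelʳ-≤ d a a⁺
      (≤-trans (+-monoʳ-≤ a d≤k) (≤-reflexive (≡.sym eq))))
    deficit-≤ {a} {a⁺} {d} {k} eq (inj₂ t+d≤) = ≤-trans (≤-reflexive (m≤n⇒m∸n≡0
      (+-cancelʳ-≤ d t a⁺ (≤-trans t+d≤ (≤-reflexive (≡.sym eq)))))) z≤n
    deficit-< : ∀ {a a⁺ d k} → a⁺ + d ≡ a + k → d < k → a < t → t ∸ a⁺ < t ∸ a
    deficit-< {a} {a⁺} {d} {k} eq d<k a<t with ≤-total a⁺ t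
    ... | inj₁ a⁺≤t = ∸-monoʳ-< {m = t} {n = a⁺} {o = a}
      (+-cancelʳ-< d a a⁺ (<-≤-trans (+-monoʳ-< a d<k) (≤-reflexive (≡.sym eq)))) a⁺≤t
    ... | inj₂ t≤a⁺ = subst (_< t ∸ a) (≡.sym (m≤n⇒m∸n≡0 t≤a⁺)) (m<n⇒0<n∸m a<t)

  swap : ∀ {x y u v} → adj Z x y ≡ true → adj Z u v ≡ true → adj G x v ≡ false → adj G u y ≡ false →
         c x ≢ c v → c u ≢ c y →
         ∀ X → X x ≡ true → X y ≡ true → X u ≡ false → X v ≡ false → cut G X < t →
         (∀ S → S x ≢ S y → S u ≢ S v → t + 2 ≤ cut G S) → Improvement
  swap {x} {y} {u} {v} xy uv ¬xv ¬uy cx≢cv cu≢cy X Xx Xy Xu Xv small large =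
    improve D N
      (∪-⊆E {A = Dx} {Du} {Z} (edge-⊆E Z x≢y xy) (edge-⊆E Z u≢v uv))
      (∪-Disjoint {A = Nx} {Nu} {G} (edge-Disjoint G x≢v ¬xv) (edge-Disjoint G u≢y ¬uy))
      (∪-Proper {A = Nx} {Nu} (edge-Proper c x≢v cx≢cv) (edge-Proper c u≢y cu≢cy))
      (λ w → trans (wD (at w)) (trans
        (exchange-ends (at w x x) (at w y y) (at w u u) (at w v v)) (≡.sym (wN (at w)))))
      (λ S → [ (λ d≤k → inj₁ (subst₂ _≤_ (≡.sym (wD _)) (≡.sym (wN _)) d≤k)) , (λ h → inj₂ h) ]′ (cuts S))
      X small
      (subst₂ _<_ (≡.sym (wD _)) (≡.sym (wN _)) (gain Xx Xy Xu Xv))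
    where
    open ≡ using (subst₂)
    separated : ∀ {p q} → X p ≡ true → X q ≡ false → p ≢ q
    separated Xp Xq refl = clash Xp Xq
    x≢y = adj⇒≢ Z xy
    u≢v = adj⇒≢ Z uv
    x≢v = separated Xx Xv
    u≢y = separated Xy Xu ∘ ≡.sym
    Dx = edge x y x≢y
    Du = edge u v u≢v
    Nx = edge x v x≢v
    Nu = edge u y u≢y
    D = Dx ∪E Du
    N = Nx ∪E Nu
    wD : ∀ f → weight D f ≡ (f x y + f y x) + (f u v + f v u)
    wD f = weight-∪₂ {A = Dx} {Du} (edges-Disjoint x≢y u≢v (separated Xx Xu) x≢v)
                   (weight-edge x≢y f) (weight-edge u≢v f)
    wN : ∀ f → weight N f ≡ (f x v + f v x) + (f u y + f y u)
    wN f = weight-∪₂ {A = Nx} {Nu} (edges-Disjoint x≢v u≢y (separated Xx Xu) x≢y)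
                   (weight-edge x≢v f) (weight-edge u≢y f)
    exchange-ends : ∀ a b d e → (a + b) + (d + e) ≡ (a + e) + (d + b)
    exchange-ends = solve-∀
    unsplit : ∀ sx sy su sv → sx ≡ sy ⊎ su ≡ sv → sep sx sy + sep su sv ≤ sep sx sv + sep su sy
    unsplit = toWitness {a? = ∀-bool? λ sx → ∀-bool? λ sy → ∀-bool? λ su → ∀-bool? λ sv →
      ((sx Bool.≟ sy) ⊎-dec (su Bool.≟ sv)) →-dec (_ ≤? _)} _
    cuts : ∀ S → sep (S x) (S y) + sep (S u) (S v) ≤ sep (S x) (S v) + sep (S u) (S y) ⊎
                 t + cut D S ≤ cut G S + cut N S
    cuts S with S x Bool.≟ S y | S u Bool.≟ S v
    ... | yes sx≡sy | _         = inj₁ (unsplit (S x) (S y) (S u) (S v) (inj₁ sx≡sy))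
    ... | no  _     | yes su≡sv = inj₁ (unsplit (S x) (S y) (S u) (S v) (inj₂ su≡sv))
    ... | no  sx≢sy | no  su≢sv = inj₂ (≤-trans
      (+-monoʳ-≤ t (≤-trans (≤-reflexive (wD _)) (+-mono-≤ (sep≤1 (S x) (S y)) (sep≤1 (S u) (S v)))))
      (≤-trans (large S sx≢sy su≢sv) (m≤m+n _ _)))
    gain : ∀ {a b d e} → a ≡ true → b ≡ true → d ≡ false → e ≡ false → sep a b + sep d e < sep a e + sep d b
    gain refl refl refl refl = s≤s z≤n

  outside-Interior : ∀ {X x z} → Interior G X x → X z ≡ false → adj G x z ≡ false
  outside-Interior (_ , inside) Xz = ¬-not λ e → clash (inside _ e) Xz

  -- Properness of c leaves at least one of the two swaps of xy and uv properly coloured.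
  swap-unless-blocked : ∀ X Y → (∀ p → Y p ≡ true → X p ≡ false) → cut G X < t → ∀ {x y u v} →
    Interior G X x → Interior G Y u → adj Z x y ≡ true → adj Z u v ≡ true →
    (∀ S → S x ≢ S y → S u ≢ S v → t + 2 ≤ cut G S) →
    Improvement ⊎ (adj G y v ≡ true × (c x ≡ c v ⊎ c u ≡ c y))
  swap-unless-blocked X Y Y⇒¬X small {x} {y} {u} {v} ix@(Xx , xin) iu@(Yu , uin) xy uv large
    with (c x ≟ c v) ⊎-dec (c u ≟ c y)
  ... | no ¬same = inj₁ (swap xy uv ¬xv ¬uy (¬same ∘ inj₁) (¬same ∘ inj₂) X Xx Xy Xu Xv small large)
    where
    Xy = xin y (Z⊆G x y xy)
    Xu = Y⇒¬X u Yu
    Xv = Y⇒¬X v (uin v (Z⊆G u v uv))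
    ¬xv = outside-Interior ix Xv
    ¬uy = outside-Interior iu (¬-not λ Yy → clash Xy (Y⇒¬X y Yy))
  ... | yes same with adj G y v in yv
  ...   | true  = inj₂ (refl , same)
  ...   | false = inj₁ (swap xy (adj-sym Z uv) (outside-Interior ix Xu) (trans (sym G v y) yv)
                    (cx≢cu same) (cv≢cy same) X Xx Xy Xv Xu small
                    (λ S sx≢sy sv≢su → large S sx≢sy (sv≢su ∘ ≡.sym)))
    where
    Xy = xin y (Z⊆G x y xy)
    Xu = Y⇒¬X u Yu
    Xv = Y⇒¬X v (uin v (Z⊆G u v uv))
    cx≢cu : c x ≡ c v ⊎ c u ≡ c y → c x ≢ c u
    cx≢cu (inj₁ cx≡cv) cx≡cu = proper u v uv (trans (≡.sym cx≡cu) cx≡cv)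
    cx≢cu (inj₂ cu≡cy) cx≡cu = proper x y xy (trans cx≡cu cu≡cy)
    cv≢cy : c x ≡ c v ⊎ c u ≡ c y → c v ≢ c y
    cv≢cy (inj₁ cx≡cv) cv≡cy = proper x y xy (trans cx≡cv cv≡cy)
    cv≢cy (inj₂ cu≡cy) cv≡cy = proper u v uv (trans cu≡cy (≡.sym cv≡cy))

-- The exchange along an alternating 8-cycle.

-- The surplus 2 pays for the two edges removed in a single swap; the `cross` term pays for the
-- further two when four edges are exchanged.
Separating : ∀ {n} → Graph n → ℕ → (Fin n → Bool) → (Fin n → Bool) → Set
Separating {n} G t X Y = ∀ S {p q r s : Fin n} → X p ≡ true → X q ≡ true → Y r ≡ true → Y s ≡ true →
                         S p ≢ S q → S r ≢ S s → t + 2 + weight G (cross X Y S) ≤ cut G S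

module EightCycle {n l} (F Z : Graph n) (c : Fin n → Fin l) (t : ℕ)
                  (Z⊥F : Disjoint Z F) (proper : Proper c Z) where

  open Rewiring F Z c t Z⊥F proper

  -- If no single swap works, the colours agree crosswise and all eight new adjacencies are free at once:
  -- trade x₁y₁, x₂y₂, u₁v₁, u₂v₂ for y₁u₁, y₂u₂, x₁v₂, x₂v₁. A set S may lose four boundary edges this way,
  -- but it then also separates y₁ from v₁ and y₂ from v₂, whose edges cross from X to Y.
  double-swap : ∀ X Y → (∀ p → Y p ≡ true → X p ≡ false) → cut G X < t → Separating G t X Y →
    ∀ {x₁ y₁ x₂ y₂ u₁ v₁ u₂ v₂} →
    Interior G X x₁ → Interior G X x₂ → Interior G Y u₁ → Interior G Y u₂ →
    adj Z x₁ y₁ ≡ true → adj Z x₂ y₂ ≡ true → adj Z u₁ v₁ ≡ true → adj Z u₂ v₂ ≡ true →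
    c x₁ ≢ c x₂ → c u₁ ≢ c u₂ → adj G y₁ v₁ ≡ true → adj G y₂ v₂ ≡ true →
    c x₁ ≡ c v₁ → c x₂ ≡ c v₂ → c y₁ ≡ c u₂ → c y₂ ≡ c u₁ → Improvement
  double-swap X Y Y⇒¬X small large {x₁} {y₁} {x₂} {y₂} {u₁} {v₁} {u₂} {v₂}
    ix₁@(Xx₁ , x₁in) ix₂@(Xx₂ , x₂in) iu₁@(Yu₁ , u₁in) iu₂@(Yu₂ , u₂in)
    x₁y₁ x₂y₂ u₁v₁ u₂v₂ cx₁≢cx₂ cu₁≢cu₂ y₁v₁ y₂v₂ cx₁≡cv₁ cx₂≡cv₂ cy₁≡cu₂ cy₂≡cu₁ =
    improve D N
      (∪-⊆E {A = D₁ ∪E D₂} {D₃ ∪E D₄} {Z}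
        (∪-⊆E {A = D₁} {D₂} {Z} (edge-⊆E Z x₁≢y₁ x₁y₁) (edge-⊆E Z x₂≢y₂ x₂y₂))
        (∪-⊆E {A = D₃} {D₄} {Z} (edge-⊆E Z u₁≢v₁ u₁v₁) (edge-⊆E Z u₂≢v₂ u₂v₂)))
      (∪-Disjoint {A = N₁ ∪E N₂} {N₃ ∪E N₄} {G}
        (∪-Disjoint {A = N₁} {N₂} {G}
          (edge-Disjoint G y₁≢u₁ (trans (sym G y₁ u₁) (outside-Interior iu₁ (X⇒¬Y Xy₁))))
          (edge-Disjoint G y₂≢u₂ (trans (sym G y₂ u₂) (outside-Interior iu₂ (X⇒¬Y Xy₂)))))
        (∪-Disjoint {A = N₃} {N₄} {G}
          (edge-Disjoint G x₁≢v₂ (outside-Interior ix₁ (Y⇒¬X v₂ Yv₂)))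
          (edge-Disjoint G x₂≢v₁ (outside-Interior ix₂ (Y⇒¬X v₁ Yv₁)))))
      (∪-Proper {A = N₁ ∪E N₂} {N₃ ∪E N₄}
        (∪-Proper {A = N₁} {N₂}
          (edge-Proper c y₁≢u₁ λ e → cu₁≢cu₂ (trans (≡.sym e) cy₁≡cu₂))
          (edge-Proper c y₂≢u₂ λ e → cu₁≢cu₂ (trans (≡.sym cy₂≡cu₁) e)))
        (∪-Proper {A = N₃} {N₄}
          (edge-Proper c x₁≢v₂ λ e → cx₁≢cx₂ (trans e (≡.sym cx₂≡cv₂)))
          (edge-Proper c x₂≢v₁ λ e → cx₁≢cx₂ (trans cx₁≡cv₁ (≡.sym e)))))
      (λ w → trans (wD (at w)) (trans
        (exchange-ends (at w x₁ x₁) (at w y₁ y₁) (at w x₂ x₂) (at w y₂ y₂)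
                       (at w u₁ u₁) (at w v₁ v₁) (at w u₂ u₂) (at w v₂ v₂))
        (≡.sym (wN (at w)))))
      cuts X small
      (subst₂ _<_ (≡.sym (wD _)) (≡.sym (wN _))
        (gain Xx₁ Xy₁ Xx₂ Xy₂ (Y⇒¬X _ Yu₁) (Y⇒¬X _ Yv₁) (Y⇒¬X _ Yu₂) (Y⇒¬X _ Yv₂)))
    where
    open ≡ using (subst₂)
    X⇒¬Y : ∀ {p} → X p ≡ true → Y p ≡ false
    X⇒¬Y Xp = ¬-not λ Yp → clash Xp (Y⇒¬X _ Yp)
    X≢Y : ∀ {p q} → X p ≡ true → Y q ≡ true → p ≢ q
    X≢Y Xp Yq refl = clash Xp (Y⇒¬X _ Yq)
    c≢ : ∀ {p q} → c p ≢ c q → p ≢ q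
    c≢ cp≢cq refl = cp≢cq refl
    Xy₁ = x₁in y₁ (Z⊆G x₁ y₁ x₁y₁)
    Xy₂ = x₂in y₂ (Z⊆G x₂ y₂ x₂y₂)
    Yv₁ = u₁in v₁ (Z⊆G u₁ v₁ u₁v₁)
    Yv₂ = u₂in v₂ (Z⊆G u₂ v₂ u₂v₂)
    x₁≢y₁ = adj⇒≢ Z x₁y₁
    x₂≢y₂ = adj⇒≢ Z x₂y₂
    u₁≢v₁ = adj⇒≢ Z u₁v₁
    u₂≢v₂ = adj⇒≢ Z u₂v₂
    y₁≢u₁ = X≢Y Xy₁ Yu₁
    y₂≢u₂ = X≢Y Xy₂ Yu₂
    x₁≢v₂ = X≢Y Xx₁ Yv₂
    x₂≢v₁ = X≢Y Xx₂ Yv₁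
    y₁≢v₁ = X≢Y Xy₁ Yv₁
    y₂≢v₂ = X≢Y Xy₂ Yv₂
    -- Between X and Y distinctness comes from disjointness. Within one side it is read off the
    -- colours: x₁ = y₂, say, would give u₁ and v₁ the same colour.
    x₁≢x₂ = c≢ cx₁≢cx₂
    x₁≢y₂ : x₁ ≢ y₂
    x₁≢y₂ = c≢ λ e → proper u₁ v₁ u₁v₁ (trans (≡.sym cy₂≡cu₁) (trans (≡.sym e) cx₁≡cv₁))
    u₁≢u₂ = c≢ cu₁≢cu₂
    u₁≢v₂ : u₁ ≢ v₂
    u₁≢v₂ = c≢ λ e → proper x₂ y₂ x₂y₂ (trans cx₂≡cv₂ (trans (≡.sym e) (≡.sym cy₂≡cu₁)))
    y₁≢y₂ : y₁ ≢ y₂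
    y₁≢y₂ = c≢ λ e → cu₁≢cu₂ (trans (≡.sym cy₂≡cu₁) (trans (≡.sym e) cy₁≡cu₂))
    y₁≢x₂ : y₁ ≢ x₂
    y₁≢x₂ = c≢ λ e → proper u₂ v₂ u₂v₂ (trans (≡.sym cy₁≡cu₂) (trans e cx₂≡cv₂))
    D₁ = edge x₁ y₁ x₁≢y₁
    D₂ = edge x₂ y₂ x₂≢y₂
    D₃ = edge u₁ v₁ u₁≢v₁
    D₄ = edge u₂ v₂ u₂≢v₂
    N₁ = edge y₁ u₁ y₁≢u₁
    N₂ = edge y₂ u₂ y₂≢u₂
    N₃ = edge x₁ v₂ x₁≢v₂
    N₄ = edge x₂ v₁ x₂≢v₁
    D = (D₁ ∪E D₂) ∪E (D₃ ∪E D₄)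
    N = (N₁ ∪E N₂) ∪E (N₃ ∪E N₄)
    union₄ : ∀ {A B A′ B′ : Graph n} → Disjoint A B → Disjoint A′ B′ →
             Disjoint A A′ → Disjoint A B′ → Disjoint B A′ → Disjoint B B′ →
             ∀ {f a b a′ b′} → weight A f ≡ a → weight B f ≡ b → weight A′ f ≡ a′ → weight B′ f ≡ b′ →
             weight ((A ∪E B) ∪E (A′ ∪E B′)) f ≡ (a + b) + (a′ + b′)
    union₄ {A} {B} {A′} {B′} AB A′B′ AA′ AB′ BA′ BB′ a b a′ b′ =
      weight-∪₂ {A = A ∪E B} {A′ ∪E B′}
        (∪-Disjoint {A = A} {B} {A′ ∪E B′} (Disjoint-∪ {A = A} {A′} {B′} AA′ AB′)
                                              (Disjoint-∪ {A = B} {A′} {B′} BA′ BB′))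
        (weight-∪₂ {A = A} {B} AB a b) (weight-∪₂ {A = A′} {B′} A′B′ a′ b′)
    wD : ∀ f → weight D f ≡ ((f x₁ y₁ + f y₁ x₁) + (f x₂ y₂ + f y₂ x₂)) + ((f u₁ v₁ + f v₁ u₁) + (f u₂ v₂ + f v₂ u₂))
    wD f = union₄ {D₁} {D₂} {D₃} {D₄}
      (edges-Disjoint x₁≢y₁ x₂≢y₂ x₁≢x₂ x₁≢y₂) (edges-Disjoint u₁≢v₁ u₂≢v₂ u₁≢u₂ u₁≢v₂)
      (edges-Disjoint x₁≢y₁ u₁≢v₁ (X≢Y Xx₁ Yu₁) (X≢Y Xx₁ Yv₁)) (edges-Disjoint x₁≢y₁ u₂≢v₂ (X≢Y Xx₁ Yu₂) x₁≢v₂)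
      (edges-Disjoint x₂≢y₂ u₁≢v₁ (X≢Y Xx₂ Yu₁) x₂≢v₁) (edges-Disjoint x₂≢y₂ u₂≢v₂ (X≢Y Xx₂ Yu₂) (X≢Y Xx₂ Yv₂))
      (weight-edge x₁≢y₁ f) (weight-edge x₂≢y₂ f) (weight-edge u₁≢v₁ f) (weight-edge u₂≢v₂ f)
    wN : ∀ f → weight N f ≡ ((f y₁ u₁ + f u₁ y₁) + (f y₂ u₂ + f u₂ y₂)) + ((f x₁ v₂ + f v₂ x₁) + (f x₂ v₁ + f v₁ x₂))
    wN f = union₄ {N₁} {N₂} {N₃} {N₄}
      (edges-Disjoint y₁≢u₁ y₂≢u₂ y₁≢y₂ (X≢Y Xy₁ Yu₂)) (edges-Disjoint x₁≢v₂ x₂≢v₁ x₁≢x₂ (X≢Y Xx₁ Yv₁))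
      (edges-Disjoint y₁≢u₁ x₁≢v₂ (x₁≢y₁ ∘ ≡.sym) (X≢Y Xy₁ Yv₂)) (edges-Disjoint y₁≢u₁ x₂≢v₁ y₁≢x₂ y₁≢v₁)
      (edges-Disjoint y₂≢u₂ x₁≢v₂ (x₁≢y₂ ∘ ≡.sym) y₂≢v₂) (edges-Disjoint y₂≢u₂ x₂≢v₁ (x₂≢y₂ ∘ ≡.sym) (X≢Y Xy₂ Yv₁))
      (weight-edge y₁≢u₁ f) (weight-edge y₂≢u₂ f) (weight-edge x₁≢v₂ f) (weight-edge x₂≢v₁ f)
    exchange-ends : ∀ a b a′ b′ d e d′ e′ → ((a + b) + (a′ + b′)) + ((d + e) + (d′ + e′)) ≡
                                            ((b + d) + (b′ + d′)) + ((a + e′) + (a′ + e))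
    exchange-ends = solve-∀
    lost gained : (Fin n → Bool) → ℕ
    lost S   = (sep (S x₁) (S y₁) + sep (S x₂) (S y₂)) + (sep (S u₁) (S v₁) + sep (S u₂) (S v₂))
    gained S = (sep (S y₁) (S u₁) + sep (S y₂) (S u₂)) + (sep (S x₁) (S v₂) + sep (S x₂) (S v₁))
    X-unsplit : ∀ a u₁ v₁ u₂ v₂ → (sep a a + sep a a) + (sep u₁ v₁ + sep u₂ v₂) ≤
                                  (sep a u₁ + sep a u₂) + (sep a v₂ + sep a v₁)
    X-unsplit = toWitness {a? = ∀-bool? λ _ → ∀-bool? λ _ → ∀-bool? λ _ → ∀-bool? λ _ → ∀-bool? λ _ → _ ≤? _} _
    Y-unsplit : ∀ b x₁ y₁ x₂ y₂ → (sep x₁ y₁ + sep x₂ y₂) + (sep b b + sep b b) ≤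
                                  (sep y₁ b + sep y₂ b) + (sep x₁ b + sep x₂ b)
    Y-unsplit = toWitness {a? = ∀-bool? λ _ → ∀-bool? λ _ → ∀-bool? λ _ → ∀-bool? λ _ → ∀-bool? λ _ → _ ≤? _} _
    loss : ∀ x₁ y₁ x₂ y₂ u₁ v₁ u₂ v₂ →
           (sep x₁ y₁ + sep x₂ y₂) + (sep u₁ v₁ + sep u₂ v₂) ≤
           2 + (sep y₁ v₁ + sep y₂ v₂) + ((sep y₁ u₁ + sep y₂ u₂) + (sep x₁ v₂ + sep x₂ v₁))
    loss = toWitness {a? = ∀-bool? λ _ → ∀-bool? λ _ → ∀-bool? λ _ → ∀-bool? λ _ →
                           ∀-bool? λ _ → ∀-bool? λ _ → ∀-bool? λ _ → ∀-bool? λ _ → _ ≤? _} _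
    crossing : ∀ S → sep (S y₁) (S v₁) + sep (S y₂) (S v₂) ≤ weight G (cross X Y S)
    crossing S = begin
      sep (S y₁) (S v₁) + sep (S y₂) (S v₂)
        ≡⟨ cong₂ _+_ (entry S Xy₁ Yv₁) (entry S Xy₂ Yv₂) ⟨
      (cross X Y S y₁ v₁ + cross X Y S v₁ y₁) + (cross X Y S y₂ v₂ + cross X Y S v₂ y₂)
        ≡⟨ weight-∪₂ {A = E₁} {E₂} (edges-Disjoint y₁≢v₁ y₂≢v₂ y₁≢y₂ (X≢Y Xy₁ Yv₂))
             (weight-edge y₁≢v₁ (cross X Y S)) (weight-edge y₂≢v₂ (cross X Y S)) ⟨
      weight (E₁ ∪E E₂) (cross X Y S)
        ≤⟨ weight-mono {H = E₁ ∪E E₂} {G}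
             (∪-⊆E {A = E₁} {E₂} {G} (edge-⊆E G y₁≢v₁ y₁v₁) (edge-⊆E G y₂≢v₂ y₂v₂)) (λ _ _ _ → ≤-refl) ⟩
      weight G (cross X Y S) ∎
      where
      open ≤-Reasoning
      E₁ = edge y₁ v₁ y₁≢v₁
      E₂ = edge y₂ v₂ y₂≢v₂
      entry : ∀ S {y v} → X y ≡ true → Y v ≡ true → cross X Y S y v + cross X Y S v y ≡ sep (S y) (S v)
      entry S {y} {v} Xy Yv rewrite Xy | Yv | X⇒¬Y Xy | Y⇒¬X v Yv with S y | S v
      ... | true  | true  = refl
      ... | true  | false = refl
      ... | false | true  = refl
      ... | false | false = refl
    bounded : ∀ S → t + 2 + weight G (cross X Y S) ≤ cut G S → t + cut D S ≤ cut G S + cut N S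
    bounded S big = begin
      t + cut D S
        ≡⟨ cong (t +_) (wD _) ⟩
      t + lost S
        ≤⟨ +-monoʳ-≤ t (loss (S x₁) (S y₁) (S x₂) (S y₂) (S u₁) (S v₁) (S u₂) (S v₂)) ⟩
      t + (2 + (sep (S y₁) (S v₁) + sep (S y₂) (S v₂)) + gained S)
        ≤⟨ +-monoʳ-≤ t (+-monoˡ-≤ (gained S) (+-monoʳ-≤ 2 (crossing S))) ⟩
      t + (2 + weight G (cross X Y S) + gained S)
        ≡⟨ regroup t (weight G (cross X Y S)) (gained S) ⟩
      t + 2 + weight G (cross X Y S) + gained S
        ≤⟨ +-monoˡ-≤ (gained S) big ⟩
      cut G S + gained S
        ≡⟨ cong (cut G S +_) (wN _) ⟨
      cut G S + cut N S ∎
      where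
      open ≤-Reasoning
      regroup : ∀ a b d → a + (2 + b + d) ≡ a + 2 + b + d
      regroup = solve-∀
    unsplit? : ∀ S p q r s → (S p ≡ S q × S p ≡ S r × S p ≡ S s) ⊎ ∃[ z ] (z ≡ q ⊎ z ≡ r ⊎ z ≡ s) × S p ≢ S z
    unsplit? S p q r s with S p Bool.≟ S q | S p Bool.≟ S r | S p Bool.≟ S s
    ... | no ≢    | _     | _     = inj₂ (q , inj₁ refl , ≢)
    ... | yes _   | no ≢  | _     = inj₂ (r , inj₂ (inj₁ refl) , ≢)
    ... | yes _   | yes _ | no ≢  = inj₂ (s , inj₂ (inj₂ refl) , ≢)
    ... | yes e   | yes e′ | yes e″ = inj₁ (e , e′ , e″)
    among : ∀ (W : Fin n → Bool) {z q r s} → W q ≡ true → W r ≡ true → W s ≡ true → z ≡ q ⊎ z ≡ r ⊎ z ≡ s → W z ≡ true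
    among W Wq Wr Ws (inj₁ refl)        = Wq
    among W Wq Wr Ws (inj₂ (inj₁ refl)) = Wr
    among W Wq Wr Ws (inj₂ (inj₂ refl)) = Ws
    -- If S is constant on the four vertices in X, or on the four in Y, the triangle inequality
    -- through the common value shows that nothing is lost. Otherwise S splits both X and Y, and
    -- `large` applies.
    cuts : ∀ S → cut D S ≤ cut N S ⊎ t + cut D S ≤ cut G S + cut N S
    cuts S with unsplit? S x₁ y₁ x₂ y₂ | unsplit? S u₁ v₁ u₂ v₂
    ... | inj₁ (e , e′ , e″) | _ = inj₁ (subst₂ _≤_ (≡.sym (wD _)) (≡.sym (wN _)) (const e e′ e″))
      where
      const : S x₁ ≡ S y₁ → S x₁ ≡ S x₂ → S x₁ ≡ S y₂ → lost S ≤ gained S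
      const e e′ e″ rewrite ≡.sym e | ≡.sym e′ | ≡.sym e″ = X-unsplit (S x₁) (S u₁) (S v₁) (S u₂) (S v₂)
    ... | inj₂ _ | inj₁ (e , e′ , e″) = inj₁ (subst₂ _≤_ (≡.sym (wD _)) (≡.sym (wN _)) (const e e′ e″))
      where
      const : S u₁ ≡ S v₁ → S u₁ ≡ S u₂ → S u₁ ≡ S v₂ → lost S ≤ gained S
      const e e′ e″ rewrite ≡.sym e | ≡.sym e′ | ≡.sym e″ = Y-unsplit (S u₁) (S x₁) (S y₁) (S x₂) (S y₂)
    ... | inj₂ (q , q∈ , Sx₁≢Sq) | inj₂ (s , s∈ , Su₁≢Ss) = inj₂ (bounded S
      (large S Xx₁ (among X Xy₁ Xx₂ Xy₂ q∈) Yu₁ (among Y Yv₁ Yu₂ Yv₂ s∈) Sx₁≢Sq Su₁≢Ss))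
    gain : ∀ {x₁ y₁ x₂ y₂ u₁ v₁ u₂ v₂} → x₁ ≡ true → y₁ ≡ true → x₂ ≡ true → y₂ ≡ true →
           u₁ ≡ false → v₁ ≡ false → u₂ ≡ false → v₂ ≡ false →
           (sep x₁ y₁ + sep x₂ y₂) + (sep u₁ v₁ + sep u₂ v₂) < (sep y₁ u₁ + sep y₂ u₂) + (sep x₁ v₂ + sep x₂ v₁)
    gain refl refl refl refl refl refl refl refl = s≤s z≤n

-- The improvement step for even t.

not-true⁻ : ∀ {b} → not b ≡ true → b ≡ false
not-true⁻ {false} _ = refl

≢-by : ∀ {a b} → a ≡ true → b ≡ false → a ≢ b
≢-by refl refl ()

Deficient : ∀ {n} → Graph n → ℕ → (Fin n → Bool) → Set
Deficient G t S = (∃[ p ] S p ≡ true) × (∃[ q ] S q ≡ false) × cut G S < t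

Deficient-resp : ∀ {n} (G : Graph n) {t S T} → S ≗ T → Deficient G t S → Deficient G t T
Deficient-resp G {t} S≗T ((p , Sp) , (q , Sq) , small) =
  (p , trans (≡.sym (S≗T p)) Sp) , (q , trans (≡.sym (S≗T q)) Sq) , subst (_< t) (cut-cong G S≗T) small

Deficient? : ∀ {n} (G : Graph n) t → Decidable (Deficient G t)
Deficient? G t S = any? (λ p → S p Bool.≟ true) ×-dec any? (λ q → S q Bool.≟ false) ×-dec (cut G S <? t)

-- Exchanging p with q, or r with s, brings S into the orientation that `separating-cut` expects.
Separating-tight : ∀ {n} (G : Graph n) h X Y → (∀ p → X p ∧ Y p ≡ false) →
                   Tight G (h + h) X → Tight G (h + h) Y → Separating G (h + h) X Y
Separating-tight G h X Y disj tX tY S {p} {q} {r} {s} Xp Xq Yr Ys Sp≢Sq Sr≢Ss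
  with S p in Sp | S q in Sq | S r in Sr | S s in Ss
... | true  | true  | _     | _     = contradiction refl Sp≢Sq
... | false | false | _     | _     = contradiction refl Sp≢Sq
... | true  | false | true  | true  = contradiction refl Sr≢Ss
... | true  | false | false | false = contradiction refl Sr≢Ss
... | false | true  | true  | true  = contradiction refl Sr≢Ss
... | false | true  | false | false = contradiction refl Sr≢Ss
... | true  | false | true  | false = separating-cut G h X Y disj tX tY S Xp Xq Yr Ys Sp Sq Sr Ss
... | true  | false | false | true  = separating-cut G h X Y disj tX tY S Xp Xq Ys Yr Sp Sq Ss Sr
... | false | true  | true  | false = separating-cut G h X Y disj tX tY S Xq Xp Yr Ys Sq Sp Sr Ss
... | false | true  | false | true  = separating-cut G h X Y disj tX tY S Xq Xp Ys Yr Sq Sp Ss Sr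

-- The complement of X has the same boundary and is deficient too, so some deficient set avoids X.
-- For a minimal Y among these, every subset avoids X as well, so Y has no smaller nonempty
-- deficient subset at all.
∃-disjoint-tight : ∀ {n} (G : Graph n) t → ∃ (Deficient G t) →
  ∃[ X ] ∃[ Y ] (∀ p → Y p ≡ true → X p ≡ false) × ∃ (λ p → X p ≡ true) × ∃ (λ p → Y p ≡ true) ×
                Tight G t X × Tight G t Y
∃-disjoint-tight {n} G t deficient
  with X , (∃Xp , (q , Xq) , smallX) , minX ← minimal-subset (Deficient-resp G) (Deficient? G t) deficient
  with Y , ((∃Yp , _ , smallY) , Y⇒¬X) , minY ← minimal-subset
    {P = λ S → Deficient G t S × (∀ p → S p ≡ true → X p ≡ false)}
    (λ S≗T (def , dis) → Deficient-resp G S≗T def , λ p Tp → dis p (trans (S≗T p) Tp))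
    (λ S → Deficient? G t S ×-dec all? λ p → (S p Bool.≟ true) →-dec (X p Bool.≟ false))
    (not ∘ X , (((q , cong not Xq) , (proj₁ ∃Xp , cong not (proj₂ ∃Xp)) ,
                 subst (_< t) (≡.sym (cut-complement G X)) smallX) , λ _ → not-true⁻))
  = X , Y , Y⇒¬X , ∃Xp , ∃Yp ,
    (smallX , λ { T T⊊X@(_ , r , _ , Tr) ∃Tp → ≮⇒≥ λ smallT → minX T T⊊X (∃Tp , (r , Tr) , smallT) }) ,
    (smallY , λ { T T⊊Y@(T⊆Y , r , _ , Tr) ∃Tp → ≮⇒≥ λ smallT →
                  minY T T⊊Y ((∃Tp , (r , Tr) , smallT) , λ p Tp → Y⇒¬X p (T⊆Y p Tp)) })

module EvenStep {n l} (F Z : Graph n) (c : Fin n → Fin l) (h : ℕ)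
                (Z⊥F : Disjoint Z F) (properF : Proper c F) (proper : Proper c Z) where

  open Rewiring F Z c (h + h) Z⊥F proper
  open EightCycle F Z c (h + h) Z⊥F proper

  trade : ∀ X Y → (∀ p → Y p ≡ true → X p ≡ false) → Tight G (h + h) X → Tight G (h + h) Y →
    ∀ {x₁ y₁ x₂ y₂ u₁ v₁ u₂ v₂} →
    Interior G X x₁ → Interior G X x₂ → Interior G Y u₁ → Interior G Y u₂ →
    adj Z x₁ y₁ ≡ true → adj Z x₂ y₂ ≡ true → adj Z u₁ v₁ ≡ true → adj Z u₂ v₂ ≡ true →
    c x₁ ≢ c x₂ → c u₁ ≢ c u₂ → Improvement
  trade X Y Y⇒¬X tX tY {x₁} {y₁} {x₂} {y₂} {u₁} {v₁} {u₂} {v₂}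
        ix₁ ix₂ iu₁ iu₂ x₁y₁ x₂y₂ u₁v₁ u₂v₂ cx₁≢cx₂ cu₁≢cu₂ =
    combine (attempt ix₁ iu₁ x₁y₁ u₁v₁) (attempt ix₁ iu₂ x₁y₁ u₂v₂)
            (attempt ix₂ iu₁ x₂y₂ u₁v₁) (attempt ix₂ iu₂ x₂y₂ u₂v₂)
    where
    small = proj₁ tX
    X∧Y : ∀ p → X p ∧ Y p ≡ false
    X∧Y p with Y p in Yp
    ... | true  = trans (∧-comm (X p) true) (Y⇒¬X p Yp)
    ... | false = ∧-comm (X p) false
    separating : Separating G (h + h) X Y
    separating = Separating-tight G h X Y X∧Y tX tY
    Blocked : (x y u v : Fin n) → Set
    Blocked x y u v = adj G y v ≡ true × (c x ≡ c v ⊎ c u ≡ c y)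
    attempt : ∀ {x y u v} → Interior G X x → Interior G Y u → adj Z x y ≡ true → adj Z u v ≡ true →
              Improvement ⊎ Blocked x y u v
    attempt {x} {y} {u} {v} ix iu xy uv = swap-unless-blocked X Y Y⇒¬X small ix iu xy uv λ S Sx≢Sy Su≢Sv →
      m+n≤o⇒m≤o (h + h + 2) (separating S (proj₁ ix) (proj₂ ix y (Z⊆G x y xy))
                                          (proj₁ iu) (proj₂ iu v (Z⊆G u v uv)) Sx≢Sy Su≢Sv)
    combine : Improvement ⊎ Blocked x₁ y₁ u₁ v₁ → Improvement ⊎ Blocked x₁ y₁ u₂ v₂ →
              Improvement ⊎ Blocked x₂ y₂ u₁ v₁ → Improvement ⊎ Blocked x₂ y₂ u₂ v₂ → Improvement
    combine (inj₁ i) _ _ _ = i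
    combine (inj₂ _) (inj₁ i) _ _ = i
    combine (inj₂ _) (inj₂ _) (inj₁ i) _ = i
    combine (inj₂ _) (inj₂ _) (inj₂ _) (inj₁ i) = i
    -- With all four swaps blocked, one colour coincidence determines the others: c x₁ = c v₁
    -- excludes c x₂ = c v₁, which settles the next pair, and so on. The other case is the same with
    -- u₁v₁ and u₂v₂ interchanged.
    combine (inj₂ (y₁v₁ , inj₁ e₁₁)) (inj₂ (_ , b₁₂)) (inj₂ (_ , b₂₁)) (inj₂ (y₂v₂ , b₂₂)) =
      double-swap X Y Y⇒¬X small separating ix₁ ix₂ iu₁ iu₂ x₁y₁ x₂y₂ u₁v₁ u₂v₂ cx₁≢cx₂ cu₁≢cu₂
        y₁v₁ y₂v₂ e₁₁ e₂₂ (≡.sym e₁₂) (≡.sym e₂₁)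
      where
      e₂₁ : c u₁ ≡ c y₂
      e₂₁ = [ (λ e → contradiction (trans e₁₁ (≡.sym e)) cx₁≢cx₂) , id ]′ b₂₁
      e₂₂ : c x₂ ≡ c v₂
      e₂₂ = [ id , (λ e → contradiction (trans e₂₁ (≡.sym e)) cu₁≢cu₂) ]′ b₂₂
      e₁₂ : c u₂ ≡ c y₁
      e₁₂ = [ (λ e → contradiction (trans e (≡.sym e₂₂)) cx₁≢cx₂) , id ]′ b₁₂
    combine (inj₂ (_ , inj₂ e₁₁)) (inj₂ (y₁v₂ , b₁₂)) (inj₂ (y₂v₁ , b₂₁)) (inj₂ (_ , b₂₂)) =
      double-swap X Y Y⇒¬X small separating ix₁ ix₂ iu₂ iu₁ x₁y₁ x₂y₂ u₂v₂ u₁v₁ cx₁≢cx₂ (cu₁≢cu₂ ∘ ≡.sym)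
        y₁v₂ y₂v₁ e₁₂ e₂₁ (≡.sym e₁₁) (≡.sym e₂₂)
      where
      e₁₂ : c x₁ ≡ c v₂
      e₁₂ = [ id , (λ e → contradiction (trans e₁₁ (≡.sym e)) cu₁≢cu₂) ]′ b₁₂
      e₂₂ : c u₂ ≡ c y₂
      e₂₂ = [ (λ e → contradiction (trans e₁₂ (≡.sym e)) cx₁≢cx₂) , id ]′ b₂₂
      e₂₁ : c x₂ ≡ c v₁
      e₂₁ = [ id , (λ e → contradiction (trans e (≡.sym e₂₂)) cu₁≢cu₂) ]′ b₂₁

  even-step : (∀ v → h + h ≤ deg G v) → (∀ v → 1 ≤ deg Z v) → ∃ (Deficient G (h + h)) → Improvement
  even-step deg≥ degZ≥1 deficient =
    let X , Y , Y⇒¬X , (x₀ , Xx₀) , (u₀ , Yu₀) , tX , tY = ∃-disjoint-tight G (h + h) deficient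
        x₁ , _ , ix₁    = interior-neighbour G X Xx₀ (<-≤-trans (proj₁ tX) (deg≥ x₀))
        -- Applying the lemma again from x₁ yields two adjacent interior vertices, which therefore
        -- differ in colour.
        x₂ , x₁x₂ , ix₂ = interior-neighbour G X (proj₁ ix₁) (<-≤-trans (proj₁ tX) (deg≥ x₁))
        u₁ , _ , iu₁    = interior-neighbour G Y Yu₀ (<-≤-trans (proj₁ tY) (deg≥ u₀))
        u₂ , u₁u₂ , iu₂ = interior-neighbour G Y (proj₁ iu₁) (<-≤-trans (proj₁ tY) (deg≥ u₁))
        _ , x₁y₁        = neighbour Z x₁ (degZ≥1 x₁)
        _ , x₂y₂        = neighbour Z x₂ (degZ≥1 x₂)
        _ , u₁v₁        = neighbour Z u₁ (degZ≥1 u₁)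
        _ , u₂v₂        = neighbour Z u₂ (degZ≥1 u₂)
    in trade X Y Y⇒¬X tX tY ix₁ ix₂ iu₁ iu₂ x₁y₁ x₂y₂ u₁v₁ u₂v₂
             (properG x₁ x₂ x₁x₂) (properG u₁ u₂ u₁u₂)
    where
    properG : Proper c G
    properG = ∪-Proper {A = F} {Z} properF proper

-- Sets without boundary, bridges and the case t = 1.

zero-cut-constant : ∀ {n} (G : Graph n) S → cut G S ≡ 0 → ∀ {p q} → adj G p q ≡ true → S p ≡ S q
zero-cut-constant G S c≡0 {p} {q} e with S p in Sp | S q in Sq
... | true  | true  = refl
... | false | false = refl
... | true  | false = contradiction (trans (≡.sym (zero-cut-closed G S c≡0 Sp e)) Sq) λ ()
... | false | true  = contradiction (trans (≡.sym (zero-cut-closed G S c≡0 Sq (adj-sym G e))) Sp) λ ()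

constant⇒zero-cut : ∀ {n} (G : Graph n) S → (∀ {p q} → adj G p q ≡ true → S p ≡ S q) → cut G S ≡ 0
constant⇒zero-cut G S const = closed⇒cut≡0 G S λ p q Sp e → trans (≡.sym (const e)) Sp

xor-cancelˡ : ∀ a {b d} → a xor b ≡ a xor d → b ≡ d
xor-cancelˡ true  {true}  {true}  _ = refl
xor-cancelˡ true  {false} {false} _ = refl
xor-cancelˡ false e = e

xor-cancelʳ : ∀ {a b} d → a xor d ≡ b xor d → a ≡ b
xor-cancelʳ {true}  {true}  _     _ = refl
xor-cancelʳ {false} {false} _     _ = refl
xor-cancelʳ {true}  {false} true  ()
xor-cancelʳ {true}  {false} false ()
xor-cancelʳ {false} {true}  true  ()
xor-cancelʳ {false} {true}  false ()

-- potential 1 G counts the sets without boundary. Those of A and their translates by S are all sets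
-- without boundary in B, and the two families are disjoint since only the translates separate x from y.
potential-doubles : ∀ {n} (A B : Graph n) S {x y} → (∀ T → cut A T ≡ 0 → cut B T ≡ 0) → cut B S ≡ 0 →
                    S x ≢ S y → (∀ T → cut A T ≡ 0 → T x ≡ T y) → potential 1 A + potential 1 A ≤ potential 1 B
potential-doubles {n} A B S {x} {y} A⇒B S-closed Sx≢Sy Tx≡Ty = begin
  potential 1 A + potential 1 A
    ≡⟨ cong (potential 1 A +_) (∑ˢ-△ n (cut-extensional A 1) S) ⟨
  potential 1 A + ∑ˢ n (λ T → 1 ∸ cut A (S △ T))
    ≡⟨ ∑ˢ-distrib-+ n _ _ ⟨
  ∑ˢ n (λ T → (1 ∸ cut A T) + (1 ∸ cut A (S △ T)))
    ≤⟨ ∑ˢ-mono n (λ T → entry T) ⟩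
  potential 1 B ∎
  where
  open ≤-Reasoning
  translate : ∀ T → cut A (S △ T) ≡ 0 → cut B T ≡ 0
  translate T ST = constant⇒zero-cut B T λ {p} {q} e → xor-cancelˡ (S p)
    (trans (zero-cut-constant B (S △ T) (A⇒B (S △ T) ST) e)
           (cong (_xor T q) (≡.sym (zero-cut-constant B S S-closed e))))
  entry : ∀ T → (1 ∸ cut A T) + (1 ∸ cut A (S △ T)) ≤ 1 ∸ cut B T
  entry T with cut A T in a | cut A (S △ T) in b
  ... | zero  | zero  = contradiction
    (xor-cancelʳ (T x) (trans (Tx≡Ty (S △ T) b) (cong (S y xor_) (≡.sym (Tx≡Ty T a))))) Sx≢Sy
  ... | zero  | suc k rewrite A⇒B T a | 0∸n≡0 k = ≤-refl
  ... | suc k | zero  rewrite translate T b | 0∸n≡0 k = ≤-refl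
  ... | suc k | suc m rewrite 0∸n≡0 k | 0∸n≡0 m = z≤n

-- Starting point for `potential-doubles`: only the empty and the full set have no boundary here.
complete : ∀ n → Graph n
complete n = record
  { adj    = λ p q → not (does (p ≟ q))
  ; sym    = λ p q → cong not (does-comm p q)
  ; irrefl = λ v → cong not (dec-true (v ≟ v) refl) }

2≤potential-complete : ∀ {n} → Fin n → 2 ≤ potential 1 (complete n)
2≤potential-complete {suc n} _ = +-mono-≤ (half true) (half false)
  where
  half : ∀ b → 1 ≤ ∑ˢ n (λ S → 1 ∸ cut (complete (suc n)) (b ▹ S))
  half b = ≤-trans (≤-reflexive (cong (1 ∸_) (≡.sym (constant⇒zero-cut (complete (suc n)) (b ▹ λ _ → b)
                     λ {p} {q} _ → trans (constant p) (≡.sym (constant q))))))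
                   (∑ˢ-term n (▹-extensional (cut-extensional (complete (suc n)) 1) b) (λ _ → b))
    where
    constant : ∀ p → (b ▹ λ _ → b) p ≡ b
    constant zero    = refl
    constant (suc p) = refl

-- The empty set, the full set, X and its complement, obtained by translating the first two by X.
4≤potential-disconnected : ∀ {n} (G : Graph n) X {p q} → X p ≡ true → X q ≡ false → cut G X ≡ 0 →
                           4 ≤ potential 1 G
4≤potential-disconnected {n} G X {p} {q} Xp Xq X-closed = ≤-trans
  (+-mono-≤ (2≤potential-complete p) (2≤potential-complete p))
  (potential-doubles (complete n) G X
    (λ T T-closed → constant⇒zero-cut G T λ _ → constant T T-closed _ _) X-closed (≢-by Xp Xq)
    (λ T T-closed → constant T T-closed p q))
  where
  constant : ∀ T → cut (complete n) T ≡ 0 → ∀ r s → T r ≡ T s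
  constant T T-closed r s with r ≟ s
  ... | yes refl = refl
  ... | no r≢s   = zero-cut-constant (complete n) T T-closed (cong not (dec-false (r ≟ s) r≢s))

-- For adjacent x and y this says that xy is the only boundary edge of some S. In terms of sets it
-- is decidable and fits `potential-doubles`.
Bridge : ∀ {n} → Graph n → Fin n → Fin n → Set
Bridge G x y = ∃[ S ] (S x ≢ S y × cut G S < 2)

bridge? : ∀ {n} (G : Graph n) x y → Dec (Bridge G x y)
bridge? G x y = ∃-subset?
  (λ S≗T (Sx≢Sy , S<2) → (λ e → Sx≢Sy (trans (S≗T x) (trans e (≡.sym (S≗T y))))) ,
                         subst (_< 2) (cut-cong G S≗T) S<2)
  (λ S → ¬? (S x Bool.≟ S y) ×-dec (cut G S <? 2))

AllBridges : ∀ {n} → Graph n → Set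
AllBridges G = ∀ x y → adj G x y ≡ true → Bridge G x y

separates-edge : ∀ {n} (G : Graph n) S {x y} → adj G x y ≡ true → S x ≢ S y → 1 ≤ cut G S
separates-edge G S {x} {y} e Sx≢Sy with cut G S in c
... | zero  = contradiction (zero-cut-constant G S c e) Sx≢Sy
... | suc _ = s≤s z≤n

-- The potential is 2 to the number of components, so this is the bound components + edges ≤ n for
-- forests. Deleting a bridge doubles the potential, which never exceeds the number of all vertex
-- sets.
forest-potential : ∀ {n} m (G : Graph n) → AllBridges G → edgeCount G ≡ m → potential 1 G * 2 ^ m ≤ 2 ^ n
forest-potential {n} zero G bridges eq = ≤-trans (≤-reflexive (*-identityʳ (potential 1 G)))
  (∑ˢ≤2^ n λ S → m∸n≤m 1 (cut G S))
forest-potential {n} (suc m) G bridges eq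
  with x , y , xy ← weight-positive G forward (subst (1 ≤_) (trans (≡.sym eq) (edgeCount≡weight G)) (s≤s z≤n))
  with S , Sx≢Sy , S<2 ← bridges x y xy = begin
  potential 1 G * 2 ^ suc m
    ≡⟨ double (potential 1 G) (2 ^ m) ⟩
  (potential 1 G + potential 1 G) * 2 ^ m
    ≤⟨ *-monoˡ-≤ (2 ^ m) (potential-doubles G G⁻ S
         (λ T T-closed → n≤0⇒n≡0 (≤-trans (cut⁻ T) (≤-reflexive T-closed))) S-closed Sx≢Sy
         (λ T T-closed → zero-cut-constant G T T-closed xy)) ⟩
  potential 1 G⁻ * 2 ^ m
    ≤⟨ forest-potential m G⁻ bridges⁻ count⁻ ⟩
  2 ^ n ∎
  where
  open ≤-Reasoning
  x≢y = adj⇒≢ G xy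
  e = edge x y x≢y
  G⁻ = G ∖E e
  e⊆G : e ⊆E G
  e⊆G = edge-⊆E G x≢y xy
  double : ∀ a b → a * (b + (b + 0)) ≡ (a + a) * b
  double = solve-∀
  cut⁻ : ∀ T → cut G⁻ T ≤ cut G T
  cut⁻ T = m+n≤o⇒m≤o (cut G⁻ T) (≤-reflexive (weight-∖ {H = e} {G} e⊆G (boundary T)))
  S-closed : cut G⁻ S ≡ 0
  -- The deleted edge is itself the one boundary edge that S may have.
  S-closed = n≤0⇒n≡0 (+-cancelʳ-≤ 1 _ 0 (≤-trans
    (+-monoʳ-≤ (cut G⁻ S) (separates-edge e S
      (∨-trueˡ (cong₂ _∧_ (dec-true (x ≟ x) refl) (dec-true (y ≟ y) refl))) Sx≢Sy))
    (≤-trans (≤-reflexive (weight-∖ {H = e} {G} e⊆G (boundary S))) (≤-pred S<2))))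
  bridges⁻ : AllBridges G⁻
  bridges⁻ p q pq with T , Tp≢Tq , T<2 ← bridges p q (∧-trueˡ pq) = T , Tp≢Tq , ≤-<-trans (cut⁻ T) T<2
  count⁻ : edgeCount G⁻ ≡ m
  count⁻ = +-cancelʳ-≡ 1 _ _ (trans (cong₂ _+_ (edgeCount≡weight G⁻)
      (≡.sym (trans (weight-edge x≢y forward) (forward-total x≢y))))
    (trans (weight-∖ {H = e} {G} e⊆G forward) (trans (≡.sym (edgeCount≡weight G)) (trans eq (≡.sym (+-comm m 1))))))

∃-nonbridge : ∀ {n} (G : Graph n) → n ∸ 1 ≤ edgeCount G → ∃ (Deficient G 1) →
              ∃[ x ] ∃[ y ] (adj G x y ≡ true × (∀ S → S x ≢ S y → 2 ≤ cut G S))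
∃-nonbridge {n} G many (X , (p , Xp) , (q , Xq) , X<1)
  with any? (λ x → any? λ y → (adj G x y Bool.≟ true) ×-dec ¬? (bridge? G x y))
... | yes (x , y , xy , nonbridge) = x , y , xy , λ S Sx≢Sy → ≮⇒≥ λ S<2 → nonbridge (S , Sx≢Sy , S<2)
... | no none = contradiction (begin-strict
    -- A disconnected graph has potential at least 4, whereas n ≤ m + 1 leaves room only for 2 in
    -- the forest bound.
    2 ^ n                       ≤⟨ ^-monoʳ-≤ 2 (≤-trans (m≤n+m∸n n 1) (s≤s many)) ⟩
    2 * 2 ^ m                   <⟨ *-monoˡ-< (2 ^ m) {{m^n≢0 2 m}} (s≤s (s≤s (s≤s (z≤n {1})))) ⟩
    4 * 2 ^ m                   ≤⟨ *-monoˡ-≤ (2 ^ m) (4≤potential-disconnected G X Xp Xq (n<1⇒n≡0 X<1)) ⟩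
    potential 1 G * 2 ^ m       ≤⟨ forest-potential m G bridges refl ⟩
    2 ^ n                       ∎) (n≮n (2 ^ n))
  where
  open ≤-Reasoning
  m = edgeCount G
  bridges : AllBridges G
  bridges x y xy with bridge? G x y
  ... | yes bridge   = bridge
  ... | no nonbridge = contradiction (x , y , xy , nonbridge) none

-- No edge leaves X, so a boundary edge of `X ∩ˢ S` ends in X outside S.
inner≥cut : ∀ {n} (G : Graph n) X S → cut G X ≡ 0 → cut G (X ∩ˢ S) ≤ weight G (inner X S)
inner≥cut G X S X-closed = weight-mono {H = G} {G} (λ _ _ → id)
  λ p q e → entry (X p) (S p) (X q) (S q) (zero-cut-constant G X X-closed e)
  where
  entry : ∀ xp sp xq sq → xp ≡ xq → ind ((xp ∧ sp) ∧ not (xq ∧ sq)) ≤ ind ((xp ∧ sp) ∧ (xq ∧ not sq))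
  entry = toWitness {a? = ∀-bool? λ xp → ∀-bool? λ _ → ∀-bool? λ xq → ∀-bool? λ _ → (xp Bool.≟ xq) →-dec (_ ≤? _)} _

module ConnectingStep {n l} (F Z : Graph n) (c : Fin n → Fin l)
                      (Z⊥F : Disjoint Z F) (proper : Proper c Z) where

  open Rewiring F Z c 1 Z⊥F proper

  -- Every vertex is interior to X or to its complement, so no edge yv can block the swap.
  connect-across : ∀ X → cut G X ≡ 0 → ∀ {x y u} → adj Z x y ≡ true → (∀ S → S x ≢ S y → 2 ≤ cut Z S) →
                   X x ≡ true → X u ≡ false → (∀ v → 1 ≤ deg Z v) → Improvement
  connect-across X X-closed {x} {y} {u} xy nonbridge Xx Xu degZ≥1 with v , uv ← neighbour Z u (degZ≥1 u) =
    [ id , (λ (yv , _) → contradiction (trans (≡.sym (interior Xy .proj₂ v yv)) (Xv v uv)) λ ()) ]′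
    (swap-unless-blocked X Y (λ _ → not-true⁻) (s≤s (≤-reflexive X-closed)) (interior Xx) iu xy uv (large uv))
    where
    Y = not ∘ X
    Y-closed : cut G Y ≡ 0
    Y-closed = trans (cut-complement G X) X-closed
    closedᶻ : ∀ W → cut G W ≡ 0 → cut Z W ≡ 0
    closedᶻ W closed = n≤0⇒n≡0 (≤-trans (weight-mono {H = Z} {G} Z⊆G (λ _ _ _ → ≤-refl)) (≤-reflexive closed))
    interior : ∀ {z} → X z ≡ true → Interior G X z
    interior Xz = Xz , λ w e → zero-cut-closed G X X-closed Xz e
    iu : Interior G Y u
    iu = cong not Xu , λ w e → zero-cut-closed G Y Y-closed (cong not Xu) e
    Xy = interior Xx .proj₂ y (Z⊆G x y xy)
    Xv : ∀ v → adj Z u v ≡ true → X v ≡ false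
    Xv v uv = not-true⁻ (iu .proj₂ v (Z⊆G u v uv))
    X∧Y : ∀ p → X p ∧ Y p ≡ false
    X∧Y p with X p
    ... | true  = refl
    ... | false = refl
    large : ∀ {v} → adj Z u v ≡ true → ∀ S → S x ≢ S y → S u ≢ S v → 3 ≤ cut G S
    large {v} uv S Sx≢Sy Su≢Sv = begin
      -- The edge xy, not being a bridge, forces two boundary edges inside X, and uv forces one
      -- outside: together t + 2 with t = 1.
      2 + 1
        ≤⟨ +-mono-≤ (nonbridge (X ∩ˢ S) (restrict {X} Xx Xy Sx≢Sy))
                    (separates-edge Z (Y ∩ˢ S) uv (restrict {Y} (cong not Xu) (cong not (Xv v uv)) Su≢Sv)) ⟩
      cut Z (X ∩ˢ S) + cut Z (Y ∩ˢ S)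
        ≤⟨ +-mono-≤ (inner≥cut Z X S (closedᶻ X X-closed)) (inner≥cut Z Y S (closedᶻ Y Y-closed)) ⟩
      weight Z (inner X S) + weight Z (inner Y S)
        ≤⟨ m+n≤o⇒m≤o _ (cut-lower-bound Z X Y S X∧Y) ⟩
      cut Z S
        ≤⟨ weight-mono {H = Z} {G} Z⊆G (λ _ _ _ → ≤-refl) ⟩
      cut G S ∎
      where
      open ≤-Reasoning
      restrict : ∀ {W p q} → W p ≡ true → W q ≡ true → S p ≢ S q → (W ∩ˢ S) p ≢ (W ∩ˢ S) q
      restrict Wp Wq Sp≢Sq rewrite Wp | Wq = Sp≢Sq

  connecting-step : n ∸ 1 ≤ edgeCount Z → (∀ v → 1 ≤ deg Z v) → ∃ (Deficient G 1) → Improvement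
  connecting-step many degZ≥1 (X , (p , Xp) , (q , Xq) , X<1)
    with x , y , xy , nonbridge ← ∃-nonbridge Z many
      (X , (p , Xp) , (q , Xq) , ≤-<-trans (weight-mono {H = Z} {G} Z⊆G (λ _ _ _ → ≤-refl)) X<1)
    with X x in Xx
  ... | true  = connect-across X (n<1⇒n≡0 X<1) xy nonbridge Xx Xq degZ≥1
  ... | false = connect-across (not ∘ X) (trans (cut-complement G X) (n<1⇒n≡0 X<1)) xy nonbridge
                               (cong not Xx) (cong not Xp) degZ≥1

-- Descent on the potential.

module Descent {n l} (F Z₀ : Graph n) (c : Fin n → Fin l) (t : ℕ) where

  record Realisation : Set where
    field
      Z        : Graph n
      disjoint : Disjoint Z F
      proper   : Proper c Z
      same-deg : ∀ v → deg Z v ≡ deg Z₀ v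

  open Realisation

  Step : Set
  Step = ∀ R → ∃ (Deficient (F ∪E R .Z) t) → Rewiring.Improvement F (R .Z) c t (R .disjoint) (R .proper)

  descend : Step → ∀ R → Acc _<_ (potential t (F ∪E R .Z)) → ∃[ R ] EdgeConnected t (F ∪E Realisation.Z R)
  descend improve R (acc rec)
    with ∃-subset? (Deficient-resp (F ∪E R .Z)) (Deficient? (F ∪E R .Z) t)
  ... | no none = R , cuts⇒EdgeConnected (F ∪E R .Z) t
    λ S Sp Sq → ≮⇒≥ λ S<t → none (S , (_ , Sp) , (_ , Sq) , S<t)
  ... | yes deficient = descend improve
    (record { Z = Z⁺ ; disjoint = disjoint⁺ ; proper = proper⁺ ; same-deg = λ v → trans (same-deg⁺ v) (same-deg R v) })
    (rec improvement)
    where open Rewiring.Improvement (improve R deficient) renaming (same-deg to same-deg⁺)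

-- Choice of t, degree bookkeeping and the theorem.

odd<3 : ∀ d → 1 ≤ d → ¬ 3 ≤ d → Odd d → d ≡ 1
odd<3 (suc zero)          _ _   _ = refl
odd<3 (suc (suc (suc _))) _ 3≰d _ = contradiction (s≤s (s≤s (s≤s z≤n))) 3≰d

*2≡+ : ∀ h → h * 2 ≡ h + h
*2≡+ = solve-∀

-- Takes t = d for even d and for d = 1, and t = d - 1 for odd d from 3 on, so that t is even except
-- when d = 1.
target : ∀ d → 1 ≤ d → ∃[ t ] (t ≤ d × (3 ≤ d → Odd d → d ∸ 1 ≤ t) × (¬ (3 ≤ d × Odd d) → d ≤ t) ×
                                (d ≡ 1 × t ≡ 1 ⊎ ∃[ h ] t ≡ h + h))
target d 1≤d with d % 2 in parity | m%n<n d 2 | m≡m%n+[m/n]*n d 2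
... | zero        | _ | d≡2h =
  d , ≤-refl , (λ _ _ → m∸n≤m d 1) , (λ _ → ≤-refl) , inj₂ (d / 2 , trans d≡2h (*2≡+ (d / 2)))
... | suc (suc _) | s≤s (s≤s ()) | _
... | suc zero    | _ | d≡1+2h with 3 ≤? d
...   | yes 3≤d = d ∸ 1 , m∸n≤m d 1 , (λ _ _ → ≤-refl) , (λ even → contradiction (3≤d , refl) even) ,
                  inj₂ (d / 2 , trans (cong (_∸ 1) d≡1+2h) (*2≡+ (d / 2)))
...   | no 3≰d =
  1 , 1≤d , (λ 3≤d → contradiction 3≤d 3≰d) ,
  (λ _ → ≤-reflexive (odd<3 d 1≤d 3≰d parity)) , inj₁ (odd<3 d 1≤d 3≰d parity , refl)

EdgeConnected-≤ : ∀ {n} (G : Graph n) {s t} → s ≤ t → EdgeConnected t G → EdgeConnected s G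
EdgeConnected-≤ G s≤t conn F F⊆G F<s = conn F F⊆G (<-≤-trans F<s s≤t)

∃-IsMinDeg : ∀ {n} (G : Graph n) → Fin n → ∃ (IsMinDeg G)
∃-IsMinDeg G v = go v (<-wellFounded (deg G v))
  where
  go : ∀ v → Acc _<_ (deg G v) → ∃ (IsMinDeg G)
  go v (acc rec) with any? (λ w → deg G w <? deg G v)
  ... | yes (w , w<v) = go w (rec w<v)
  ... | no none       = deg G v , (v , refl) , λ w → ≮⇒≥ λ w<v → none (w , w<v)

IsMinDeg-unique : ∀ {n} (G : Graph n) {d e} → IsMinDeg G d → IsMinDeg G e → d ≡ e
IsMinDeg-unique G ((v , refl) , d≤) ((w , refl) , e≤) = ≤-antisym (d≤ w) (e≤ v)

-- Carries the lower bound on the number of edges from the initial Z₀ to every later Z.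
edgeCount-deg : ∀ {n} (G H : Graph n) → (∀ v → deg G v ≡ deg H v) → edgeCount G ≡ edgeCount H
edgeCount-deg G H degs = *-cancelˡ-≡ (edgeCount G) (edgeCount H) 2 (trans (twice (edgeCount G)) (trans
  (trans (handshake G) (trans (∑-cong degs) (≡.sym (handshake H)))) (≡.sym (twice (edgeCount H)))))
  where
  twice : ∀ a → 2 * a ≡ a + a
  twice = solve-∀

deg-∪ : ∀ {n} {A B : Graph n} → Disjoint A B → ∀ v → deg (A ∪E B) v ≡ deg A v + deg B v
deg-∪ {A = A} {B} A⊥B v = trans (deg≡weight (A ∪E B) v) (trans (weight-∪ {A = A} {B} A⊥B (at v))
  (≡.sym (cong₂ _+_ (deg≡weight A v) (deg≡weight B v))))

deg-∖ : ∀ {n} {H G : Graph n} → H ⊆E G → ∀ v → deg (G ∖E H) v + deg H v ≡ deg G v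
deg-∖ {H = H} {G} H⊆G v = trans (cong₂ _+_ (deg≡weight (G ∖E H) v) (deg≡weight H v))
  (trans (weight-∖ {H = H} {G} H⊆G (at v)) (≡.sym (deg≡weight G v)))

module _ {n l} (G₀ Z₀ : Graph n) (c : Fin n → Fin l) (proper₀ : Proper c G₀) (Z₀⊆G₀ : Z₀ ⊆E G₀)
         (degZ₀≥1 : ∀ v → 1 ≤ deg Z₀ v) where

  private
    F : Graph n
    F = G₀ ∖E Z₀

  properF : Proper c F
  properF p q e = proper₀ p q (∧-trueˡ e)

  module _ (t : ℕ) where
    open Descent F Z₀ c t

    initial : Realisation
    initial = record
      { Z        = Z₀
      ; disjoint = λ p q z → ¬-not λ f → clash z (proj₂ (∖E⁻ G₀ Z₀ {p} {q} f))
      ; proper   = λ p q z → proper₀ p q (Z₀⊆G₀ p q z)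
      ; same-deg = λ _ → refl }

    union-deg : ∀ R v → deg (F ∪E Realisation.Z R) v ≡ deg G₀ v
    union-deg R v = trans (deg-∪ {A = F} {Z} (Disjoint-sym {A = Z} {F} disjoint) v)
      (trans (cong (deg F v +_) (same-deg v)) (deg-∖ {H = Z₀} {G₀} Z₀⊆G₀ v))
      where open Realisation R

    union-proper : ∀ R → Proper c (F ∪E Realisation.Z R)
    union-proper R = ∪-Proper {A = F} {Realisation.Z R} properF (Realisation.proper R)

    degZ≥1 : ∀ R v → 1 ≤ deg (Realisation.Z R) v
    degZ≥1 R v = subst (1 ≤_) (≡.sym (Realisation.same-deg R v)) (degZ₀≥1 v)

    reach : Step → ∃[ R ] EdgeConnected t (F ∪E Realisation.Z R)
    reach improve = descend improve initial (<-wellFounded _)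

  realise : ∀ {d t} → (∀ v → d ≤ deg G₀ v) → t ≤ d → (d ≡ 1 → n ∸ 1 ≤ edgeCount Z₀) →
            d ≡ 1 × t ≡ 1 ⊎ ∃[ h ] t ≡ h + h →
            ∃[ R ] EdgeConnected t (F ∪E Descent.Realisation.Z {F = F} {Z₀} {c} {t} R)
  realise d≤ t≤d many (inj₁ (d≡1 , refl)) = reach 1 λ R → let open Descent.Realisation R in
    ConnectingStep.connecting-step F Z c disjoint proper
      (subst (n ∸ 1 ≤_) (≡.sym (edgeCount-deg Z Z₀ same-deg)) (many d≡1)) (degZ≥1 1 R)
  realise d≤ t≤d many (inj₂ (h , refl)) = reach (h + h) λ R → let open Descent.Realisation R in
    EvenStep.even-step F Z c h disjoint properF proper
      (λ v → subst (h + h ≤_) (≡.sym (union-deg (h + h) R v)) (≤-trans t≤d (d≤ v))) (degZ≥1 (h + h) R)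

  1≤degG₀ : ∀ v → 1 ≤ deg G₀ v
  1≤degG₀ v = ≤-trans (degZ₀≥1 v) (≤-trans (m≤n+m _ _) (≤-reflexive (deg-∖ {H = Z₀} {G₀} Z₀⊆G₀ v)))

  -- Equal degrees give G the minimum degree of G₀. The upper bound on its connectivity comes from
  -- deleting the edges at a vertex of minimum degree.
  connectivity : ∀ {d t} G → IsMinDeg G₀ d → (∀ v → deg G v ≡ deg G₀ v) → EdgeConnected t G →
    (3 ≤ d → Odd d → d ∸ 1 ≤ t) → (¬ (3 ≤ d × Odd d) → d ≤ t) →
    ∀ e → IsMinDeg G e → (3 ≤ e → Odd e → EdgeConnected (e ∸ 1) G) × (¬ (3 ≤ e × Odd e) → MaximallyEdgeConnected G)
  connectivity {d} {t} G min degs connected odd-case other-case e minG@((w₀ , degw₀) , e≤)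
    with refl ← IsMinDeg-unique G₀ ((w₀ , trans (≡.sym (degs w₀)) degw₀) , λ u → subst (e ≤_) (degs u) (e≤ u)) min
    = (λ 3≤d odd → EdgeConnected-≤ G (odd-case 3≤d odd) connected) ,
      (λ other k minG′ → maximal minG′ (other-case other))
    where
    maximal : ∀ {k} → IsMinDeg G k → e ≤ t → IsEdgeConnectivity G k
    maximal minG′@((w , refl) , _) e≤t =
      EdgeConnected-≤ G (≤-trans (≤-reflexive (IsMinDeg-unique G minG′ minG)) e≤t) connected ,
      ¬EdgeConnected-suc-deg G w (subst (1 ≤_) (≡.sym (degs w)) (1≤degG₀ w))

theorem7 : ∀ {n : ℕ} (l : ℕ) (G0 Z0 : Graph n) → EquitablyColorable G0 l → Z0 ⊆E G0 → (∀ v → 1 ≤ deg Z0 v) → (IsMinDeg G0 1 → n ∸ 1 ≤ edgeCount Z0) → Σ (Graph n) (λ G → EquitablyColorable G l × InR G0 (G0 ∖E Z0) G × (∀ d → IsMinDeg G d → (3 ≤ d → Odd d → EdgeConnected (d ∸ 1) G) × (¬ (3 ≤ d × Odd d) → MaximallyEdgeConnected G)))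
-- Without vertices there is no minimum degree, and the connectivity clauses hold vacuously.
theorem7 {zero} l G0 Z0 colourable _ _ _ =
  G0 , colourable , ((λ _ → refl) , λ _ _ → ∧-trueˡ) , λ { _ ((() , _) , _) }
theorem7 {suc _} l G0 Z0 (c , proper , equitable) Z0⊆G0 degZ0≥1 many =
  let d , min@((v , degv) , d≤) = ∃-IsMinDeg G0 zero
      t , t≤d , odd-case , other-case , shape =
        target d (subst (1 ≤_) degv (1≤degG₀ G0 Z0 c proper Z0⊆G0 degZ0≥1 v))
      R , connected = realise G0 Z0 c proper Z0⊆G0 degZ0≥1 d≤ t≤d
        (λ d≡1 → many (subst (IsMinDeg G0) d≡1 min)) shape
      G = (G0 ∖E Z0) ∪E Descent.Realisation.Z R
      degs = union-deg G0 Z0 c proper Z0⊆G0 degZ0≥1 t R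
  -- Class sizes depend on c alone, so `equitable` carries over to G unchanged.
  in G , (c , union-proper G0 Z0 c proper Z0⊆G0 degZ0≥1 t R , equitable) ,
     (degs , ⊆E-∪ˡ (G0 ∖E Z0) (Descent.Realisation.Z R)) ,
     connectivity G0 Z0 c proper Z0⊆G0 degZ0≥1 G min degs connected odd-case other-case
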